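{- Fix $\alpha$ with $$0<\alpha\le\frac{\sqrt5-1}{2}.$$ For every integer $N\ge1$, every $p\in(0,1)$, and every random set $J\subseteq[N]$ whose law is $\alpha p$-spread, if $X_\alpha\sim\mu_\alpha$ is independent of $J$, then $$J\cap X_\alpha\le_d X_p,$$ where $X_p$ denotes a random set of law $\mu_p$; that is, there exists a coupling $(A,B)$ in which $A$ has the law of $J\cap X_\alpha$, $B$ has law $\mu_p$, and $A\subseteq B$ almost surely. In particular, this holds with $\alpha=1/2$, for every integer $N\ge1$, every $p\in(0,1)$, and every random set $J\subseteq[N]$ whose law is $\tfrac12 p$-spread.
   Context: $[N]=\{1,\dots,N\}$. For $0<s<1$, $\mu_s$ is the product probability measure on $2^{[N]}$ given by $\mu_s(A)=s^{|A|}(1-s)^{N-|A|}$ for $A\subseteq[N]$. A probability measure $\nu$ on $2^{[N]}$ is $q$-spread if a random set $J\sim\nu$ satisfies $\mathbb{P}(I\subseteq J)\le q^{|I|}$ for all $I\subseteq[N]$; a random set is called $q$-spread if its law is. For random sets $Y,Z\subseteq[N]$, $Y\le_d Z$ means that there exists a coupling $(A,B)$ of the laws of $Y$ and $Z$ (i.e. $A$ has the law of $Y$ and $B$ has the law of $Z$) with $A\subseteq B$ almost surely. -}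

module Defs where

open import Level using (0ℓ)
open import Algebra.Bundles using (CommutativeRing)
open import Data.Bool.Base using (if_then_else_)
import Data.Bool.Properties as Bool
open import Data.Empty using (⊥-elim)
open import Data.Fin.Subset using (Subset; inside; outside; _∩_; _⊆_; ∣_∣)
open import Data.Fin.Subset.Properties using (_⊆?_)
open import Data.Nat.Base using (ℕ; zero; suc; _∸_)
open import Data.Product.Base using (∃; ∃-syntax; _×_; _,_; proj₁; proj₂)
open import Data.Sum.Base using (inj₁; inj₂)
open import Data.Vec.Base using ([]; _∷_)
import Data.Vec.Properties as Vec
open import Relation.Binary.Construct.StrictToNonStrict using () renaming (_≤_ to NonStrict)
open import Relation.Binary.Core using (Rel)
open import Relation.Binary.Definitions using (DecidableEquality; tri<; tri≈; tri>)
open import Relation.Binary.Structures using (IsStrictTotalOrder)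
import Relation.Binary.Definitions as B
open import Relation.Nullary using (¬_; does)
open import Relation.Unary using (Pred; Decidable)

-- The real numbers, characterised up to isomorphism as the complete ordered
-- field.  The order is the classical one: `compare` decides trichotomy.

record CompleteOrderedField : Set₁ where
  infix 4 _<_ _≤_
  field
    commutativeRing : CommutativeRing 0ℓ 0ℓ

  open CommutativeRing commutativeRing public

  field
    _<_                : Rel Carrier 0ℓ
    isStrictTotalOrder : IsStrictTotalOrder _≈_ _<_
    0<1                : 0# < 1#
    +-monoˡ-<          : ∀ z {x y} → x < y → x + z < y + z
    *-pos              : ∀ {x y} → 0# < x → 0# < y → 0# < x * y
    inverse            : ∀ x → ¬ (x ≈ 0#) → ∃[ y ] x * y ≈ 1#

  open IsStrictTotalOrder isStrictTotalOrder public
    using (compare; <-resp-≈; <-respʳ-≈; <-respˡ-≈)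
    renaming (trans to <-trans; irrefl to <-irrefl)

  -- x < y or x ≈ y
  _≤_ : Rel Carrier 0ℓ
  _≤_ = NonStrict _≈_ _<_

  UpperBound : Pred Carrier 0ℓ → Carrier → Set
  UpperBound S b = ∀ x → S x → x ≤ b

  field
    supremum : ∀ (S : Pred Carrier 0ℓ) → ∃ S → ∃ (UpperBound S) →
               ∃[ s ] UpperBound S s × (∀ b → UpperBound S b → s ≤ b)

  2# 5# : Carrier
  2# = 1# + 1#
  5# = 2# + 2# + 1#

module Constants (ℝ : CompleteOrderedField) where
  open CompleteOrderedField ℝ

  private
    open import Algebra.Solver.Ring.NaturalCoefficients.Default commutativeSemiring
      using (solve; _:=_; _:+_; _:*_; con)
    open import Relation.Binary.Reasoning.Setoid setoid

    pos⇒≉0 : ∀ {x} → 0# < x → ¬ (x ≈ 0#)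
    pos⇒≉0 0<x x≈0 = <-irrefl (sym x≈0) 0<x

    +-monoʳ-< : ∀ z {x y} → x < y → z + x < z + y
    +-monoʳ-< z {x} {y} x<y =
      <-respˡ-≈ (+-comm x z) (<-respʳ-≈ (+-comm y z) (+-monoˡ-< z x<y))

    +-pos : ∀ {x y} → 0# < x → 0# < y → 0# < x + y
    +-pos {x} 0<x 0<y = <-trans 0<x (<-respˡ-≈ (+-identityʳ x) (+-monoʳ-< x 0<y))

    x<x+y : ∀ x {y} → 0# < y → x < x + y
    x<x+y x 0<y = <-respˡ-≈ (+-identityʳ x) (+-monoʳ-< x 0<y)

    difference : ∀ {x y} → x < y → ∃[ d ] 0# < d × y ≈ x + d
    difference {x} {y} x<y = y - x
      , <-respˡ-≈ (-‿inverseʳ x) (+-monoˡ-< (- x) x<y)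
      , (begin
          y                ≈⟨ +-identityʳ y ⟨
          y + 0#           ≈⟨ +-congˡ (-‿inverseˡ x) ⟨
          y + (- x + x)    ≈⟨ +-assoc y (- x) x ⟨
          (y - x) + x      ≈⟨ +-comm (y - x) x ⟩
          x + (y - x)      ∎)

    *-monoʳ-< : ∀ {x y z} → 0# < z → x < y → x * z < y * z
    *-monoʳ-< {x} {y} {z} 0<z x<y with difference x<y
    ... | d , 0<d , y≈x+d =
      <-respʳ-≈ (trans (sym (distribʳ z x d)) (*-congʳ (sym y≈x+d)))
        (x<x+y (x * z) (*-pos 0<d 0<z))

    square-mono : ∀ {x y} → 0# < x → x < y → x * x < y * y
    square-mono {x} {y} 0<x x<y =
      <-trans (*-monoʳ-< 0<x x<y)
        (<-respˡ-≈ (*-comm x y) (*-monoʳ-< (<-trans 0<x x<y) x<y))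

    ≮⇒≥ : ∀ {x y} → ¬ (x < y) → y ≤ x
    ≮⇒≥ {x} {y} x≮y with compare x y
    ... | tri< x<y _ _ = ⊥-elim (x≮y x<y)
    ... | tri≈ _ x≈y _ = inj₂ (sym x≈y)
    ... | tri> _ _ y<x = inj₁ y<x

    ≤⇒≯ : ∀ {x y} → x ≤ y → ¬ (y < x)
    ≤⇒≯ (inj₁ x<y) y<x = <-irrefl refl (<-trans x<y y<x)
    ≤⇒≯ (inj₂ x≈y) y<x = <-irrefl (sym x≈y) y<x

    0<2 : 0# < 2#
    0<2 = +-pos 0<1 0<1

    0<4 : 0# < 2# + 2#
    0<4 = +-pos 0<2 0<2

    0<5 : 0# < 5#
    0<5 = +-pos 0<4 0<1

    1<5 : 1# < 5#
    1<5 = <-respʳ-≈ (+-comm 1# (2# + 2#)) (x<x+y 1# 0<4)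

    inverse-pos : ∀ {x} (0<x : 0# < x) → ∃[ y ] 0# < y × x * y ≈ 1#
    inverse-pos {x} 0<x with inverse x (pos⇒≉0 0<x)
    ... | y , xy≈1 with compare 0# y
    ... | tri< 0<y _ _ = y , 0<y , xy≈1
    ... | tri≈ _ 0≈y _ = ⊥-elim
      (pos⇒≉0 0<1 (trans (sym xy≈1) (trans (*-congˡ (sym 0≈y)) (zeroʳ x))))
    ... | tri> _ _ y<0 = ⊥-elim (<-irrefl refl (<-trans 0<1
      (<-respˡ-≈ (trans (*-comm y x) xy≈1) (<-respʳ-≈ (zeroˡ x) (*-monoʳ-< 0<x y<0)))))

    am-gm-< : ∀ {x y} → 0# < x → x < y → (2# + 2#) * (x * y) < (x + y) * (x + y)
    am-gm-< {x} {y} 0<x x<y with difference x<y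
    ... | d , 0<d , y≈x+d =
      <-respˡ-≈ (*-congˡ (*-congˡ (sym y≈x+d)))
      (<-respʳ-≈ (trans (identity x d) (*-cong (+-congˡ (sym y≈x+d)) (+-congˡ (sym y≈x+d))))
        (x<x+y _ (*-pos 0<d 0<d)))
      where
      identity : ∀ x d → (2# + 2#) * (x * (x + d)) + d * d ≈ (x + (x + d)) * (x + (x + d))
      identity = solve 2 (λ x d →
        ((con 1 :+ con 1) :+ (con 1 :+ con 1)) :* (x :* (x :+ d)) :+ d :* d
          := (x :+ (x :+ d)) :* (x :+ (x :+ d))) refl

    am-gm : ∀ {x y} → 0# < x → 0# < y → ¬ (x ≈ y) →
            (2# + 2#) * (x * y) < (x + y) * (x + y)
    am-gm {x} {y} 0<x 0<y x≉y with compare x y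
    ... | tri< x<y _ _ = am-gm-< 0<x x<y
    ... | tri≈ _ x≈y _ = ⊥-elim (x≉y x≈y)
    ... | tri> _ _ y<x =
      <-respˡ-≈ (*-congˡ (*-comm y x))
      (<-respʳ-≈ (*-cong (+-comm y x) (+-comm y x)) (am-gm-< 0<y y<x))

    S : Pred Carrier 0ℓ
    S x = x * x ≤ 5#

    bound : ∀ {b} → 0# < b → 5# ≤ b * b → UpperBound S b
    bound 0<b 5≤bb x xx≤5 = ≮⇒≥ λ b<x → go xx≤5 5≤bb (square-mono 0<b b<x)
      where
      go : ∀ {u v} → u ≤ 5# → 5# ≤ v → ¬ (v < u)
      go u≤5 (inj₁ 5<v) v<u = ≤⇒≯ u≤5 (<-trans 5<v v<u)
      go u≤5 (inj₂ 5≈v) v<u = ≤⇒≯ u≤5 (<-respˡ-≈ (sym 5≈v) v<u)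

    5≤5*5 : 5# ≤ 5# * 5#
    5≤5*5 = inj₁ (<-respˡ-≈ (*-identityˡ 5#) (*-monoʳ-< 0<5 1<5))

    sup-S : ∃[ s ] UpperBound S s × (∀ b → UpperBound S b → s ≤ b)
    sup-S = supremum S (1# , inj₁ (<-respˡ-≈ (sym (*-identityˡ 1#)) 1<5)) (5# , bound 0<5 5≤5*5)

    s : Carrier
    s = proj₁ sup-S

    0<s : 0# < s
    0<s with proj₁ (proj₂ sup-S) 1# (inj₁ (<-respˡ-≈ (sym (*-identityˡ 1#)) 1<5))
    ... | inj₁ 1<s = <-trans 0<1 1<s
    ... | inj₂ 1≈s = <-respʳ-≈ 1≈s 0<1

    -- The Newton iterate ½ (s + 5 / s) and its conjugate refute s² ≉ 5.

    s²≮5 : ¬ (s * s < 5#)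
    s²≮5 s²<5 with inverse-pos (+-pos (*-pos 0<s 0<s) 0<5)
    ... | e , 0<e , de≈1 = ≤⇒≯ (proj₁ (proj₂ sup-S) t (inj₁ t²<5)) s<t
      where
      d = s * s + 5#
      t = (s * (5# + 5#)) * e
      s<t : s < t
      s<t = <-respˡ-≈ (trans (*-assoc s d e) (trans (*-congˡ de≈1) (*-identityʳ s)))
        (*-monoʳ-< 0<e (<-respˡ-≈ (*-comm d s) (<-respʳ-≈ (*-comm (5# + 5#) s)
          (*-monoʳ-< 0<s (+-monoˡ-< 5# s²<5)))))
      t²<5 : t * t < 5#
      t²<5 = <-respˡ-≈ (lhs s 5# e) (<-respʳ-≈
        (begin
          d * d * (5# * (e * e))       ≈⟨ rhs d 5# e ⟩
          5# * ((d * e) * (d * e))     ≈⟨ *-congˡ (*-cong de≈1 de≈1) ⟩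
          5# * (1# * 1#)               ≈⟨ *-congˡ (*-identityˡ 1#) ⟩
          5# * 1#                      ≈⟨ *-identityʳ 5# ⟩
          5#                           ∎)
        (*-monoʳ-< (*-pos 0<5 (*-pos 0<e 0<e))
          (am-gm (*-pos 0<s 0<s) 0<5 (λ eq → <-irrefl eq s²<5))))
        where
        lhs : ∀ s f e → (2# + 2#) * (s * s * f) * (f * (e * e)) ≈
                        s * (f + f) * e * (s * (f + f) * e)
        lhs = solve 3 (λ s f e →
          ((con 1 :+ con 1) :+ (con 1 :+ con 1)) :* (s :* s :* f) :* (f :* (e :* e))
            := s :* (f :+ f) :* e :* (s :* (f :+ f) :* e)) refl
        rhs : ∀ d f e → d * d * (f * (e * e)) ≈ f * ((d * e) * (d * e))
        rhs = solve 3 (λ d f e → d :* d :* (f :* (e :* e)) := f :* ((d :* e) :* (d :* e))) refl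

    5≮s² : ¬ (5# < s * s)
    5≮s² 5<s² with inverse-pos (+-pos 0<s 0<s)
    ... | k , 0<k , 2sk≈1 = ≤⇒≯ (proj₂ (proj₂ sup-S) m (bound (*-pos 0<d 0<k) (inj₁ 5<m²))) m<s
      where
      d = s * s + 5#
      m = d * k
      0<d = +-pos (*-pos 0<s 0<s) 0<5
      m<s : m < s
      m<s = <-respʳ-≈
        (begin
          (s * s + s * s) * k   ≈⟨ *-congʳ (distribˡ s s s) ⟨
          s * (s + s) * k       ≈⟨ *-assoc s (s + s) k ⟩
          s * ((s + s) * k)     ≈⟨ *-congˡ 2sk≈1 ⟩
          s * 1#                ≈⟨ *-identityʳ s ⟩
          s                     ∎)
        (*-monoʳ-< 0<k (+-monoʳ-< (s * s) 5<s²))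
      5<m² : 5# < m * m
      5<m² = <-respˡ-≈
        (begin
          (2# + 2#) * (s * s * 5#) * (k * k)         ≈⟨ lhs s 5# k ⟩
          5# * (((s + s) * k) * ((s + s) * k))       ≈⟨ *-congˡ (*-cong 2sk≈1 2sk≈1) ⟩
          5# * (1# * 1#)                             ≈⟨ *-congˡ (*-identityˡ 1#) ⟩
          5# * 1#                                    ≈⟨ *-identityʳ 5# ⟩
          5#                                         ∎)
        (<-respʳ-≈ (rhs d k)
          (*-monoʳ-< (*-pos 0<k 0<k)
            (am-gm (*-pos 0<s 0<s) 0<5 (λ eq → <-irrefl (sym eq) 5<s²))))
        where
        lhs : ∀ s f k → (2# + 2#) * (s * s * f) * (k * k) ≈ f * (((s + s) * k) * ((s + s) * k))
        lhs = solve 3 (λ s f k →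
          ((con 1 :+ con 1) :+ (con 1 :+ con 1)) :* (s :* s :* f) :* (k :* k)
            := f :* (((s :+ s) :* k) :* ((s :+ s) :* k))) refl
        rhs : ∀ d k → d * d * (k * k) ≈ d * k * (d * k)
        rhs = solve 2 (λ d k → d :* d :* (k :* k) := d :* k :* (d :* k)) refl

    s²≈5 : s * s ≈ 5#
    s²≈5 with compare (s * s) 5#
    ... | tri< s²<5 _ _ = ⊥-elim (s²≮5 s²<5)
    ... | tri≈ _ s²≈5 _ = s²≈5
    ... | tri> _ _ 5<s² = ⊥-elim (5≮s² 5<s²)

  sqrt5 : ∃[ r ] 0# < r × r * r ≈ 5#
  sqrt5 = s , 0<s , s²≈5

  √5 : Carrier
  √5 = proj₁ sqrt5

  half : ∃[ h ] 2# * h ≈ 1#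
  half = inverse 2# (pos⇒≉0 0<2)

  ½ : Carrier
  ½ = proj₁ half

-- Random subsets of [n] enter only through their laws, and laws on the finite
-- set 2^[n] are given by their mass functions.

module RandomSets (ℝ : CompleteOrderedField) where
  open CompleteOrderedField ℝ
  open import Algebra.Properties.Semiring.Exp semiring public using (_^_)

  infix 4 _≐_ _≤d_

  _≟ˢ_ : ∀ {n} → DecidableEquality (Subset n)
  _≟ˢ_ = Vec.≡-dec Bool._≟_

  -- The sum of f A over all A ⊆ [n], splitting on whether A contains the
  -- first element.
  ∑ : ∀ {n} → (Subset n → Carrier) → Carrier
  ∑ {zero}  f = f []
  ∑ {suc n} f = ∑ (λ A → f (outside ∷ A)) + ∑ (λ A → f (inside ∷ A))

  Law : ℕ → Set
  Law n = Subset n → Carrier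

  _≐_ : ∀ {n} → Rel (Law n) 0ℓ
  ν ≐ ν′ = ∀ A → ν A ≈ ν′ A

  Pr : ∀ {n} → Law n → {E : Pred (Subset n) 0ℓ} → Decidable E → Carrier
  Pr ν E? = ∑ λ A → if does (E? A) then ν A else 0#

  -- The joint law of a pair of random subsets of [n].
  JointLaw : ℕ → Set
  JointLaw n = Subset n → Subset n → Carrier

  IsProbability : ∀ {n} → JointLaw n → Set
  IsProbability κ = (∀ A B → 0# ≤ κ A B) × ∑ (λ A → ∑ (κ A)) ≈ 1#

  Pr₂ : ∀ {n} → JointLaw n → {E : Rel (Subset n) 0ℓ} → B.Decidable E → Carrier
  Pr₂ κ E? = ∑ λ A → ∑ λ B → if does (E? A B) then κ A B else 0#

  law₁ law₂ : ∀ {n} → JointLaw n → Law n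
  law₁ κ A = ∑ λ B → κ A B
  law₂ κ B = ∑ λ A → κ A B

  -- The law of the intersection of the two random sets.
  law∩ : ∀ {n} → JointLaw n → Law n
  law∩ κ C = Pr₂ κ (λ A B → (A ∩ B) ≟ˢ C)

  Independent : ∀ {n} → JointLaw n → Set
  Independent κ = ∀ A B → κ A B ≈ law₁ κ A * law₂ κ B

  μ : ∀ {n} → Carrier → Law n
  μ {n} s A = s ^ ∣ A ∣ * (1# - s) ^ (n ∸ ∣ A ∣)

  Spread : ∀ {n} → Carrier → Law n → Set
  Spread q ν = ∀ I → Pr ν (I ⊆?_) ≤ q ^ ∣ I ∣

  _≤d_ : ∀ {n} → Rel (Law n) 0ℓ
  _≤d_ {n} ν ν′ = ∃[ κ ] IsProbability {n} κ × law₁ κ ≐ ν × law₂ κ ≐ ν′ × Pr₂ κ _⊆?_ ≈ 1#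

{-# OPTIONS --safe #-}

-- By Strassen's theorem it suffices that P(J ∩ X_α ∈ V) ≥ μ_p(V) for every
-- downset V.  Let h be the indicator of V, let Q_J(h) be a suitably weighted sum
-- of the squared p-biased Fourier coefficients ĥ(I)² over I ⊆ J, and let L_J be
-- the probability that J ∩ X_α ∈ V for fixed J.  Using 2x ≤ 1 + x² coordinate by
-- coordinate,
--   2 μ_p(V) ≤ L_J + Q_J(h)   for every J.
-- Averaging over a spread J replaces 1[I ⊆ J] by at most (αp)^|I|; since
-- α² ≤ 1 - α this is absorbed by the weights, and Parseval bounds the mean of
-- Q_J(h) by the p-mean of h² = h, which is μ_p(V).
module Submission where

open import Defs
import Algebra.Properties.Ring as RingProperties
import Algebra.Solver.Ring.NaturalCoefficients.Default as NaturalSolver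
open import Data.Bool.Base using (Bool; true; false; if_then_else_; _∧_; _∨_)
import Data.Bool.Properties as Bool
open import Data.Empty using (⊥-elim)
open import Data.Fin.Subset using (Subset; inside; outside; _∩_; _⊆_; ∣_∣)
import Data.Fin.Subset.Properties as Sub
open import Data.Fin.Subset.Properties using (_⊆?_)
open import Data.List.Base using (List; []; _∷_; _++_; map; cartesianProduct; cartesianProductWith)
open import Data.List.Membership.Propositional using (_∈_)
open import Data.List.Membership.Propositional.Properties
  using (∈-++⁺ˡ; ∈-++⁺ʳ; ∈-map⁺; ∈-cartesianProduct⁺; ∈-cartesianProductWith⁺; ∈-cartesianProductWith⁻)
open import Data.List.Relation.Unary.Any using (here; there)
open import Data.Nat.Base as ℕ using (ℕ; zero; suc)
import Data.Nat.Properties as ℕ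
open import Data.Product.Base using (∃-syntax; _×_; _,_; proj₁; proj₂)
open import Data.Sum.Base using (_⊎_; inj₁; inj₂; [_,_]′)
open import Data.Vec.Base as Vec using ([]; _∷_)
open import Function.Base using (_∘_; const)
open import Relation.Binary.Bundles using (Poset)
import Relation.Binary.Construct.StrictToNonStrict as NonStrict
open import Relation.Binary.Definitions using (tri<; tri≈; tri>)
open import Relation.Binary.PropositionalEquality.Core as ≡ using (_≡_; _≢_)
import Relation.Binary.Reasoning.PartialOrder as PosetReasoning
open import Relation.Binary.Structures using (IsTotalOrder)
open import Relation.Nullary using (¬_; does; yes; no)
open import Relation.Nullary.Decidable using (dec-true; dec-false)

-- Fix `J` and unfold the coordinates. The mean of `h` becomes a mean, over the kept part of `J`, of
-- signed numbers that vanish unless that part lies in V, and Q_J(h) becomes the mean of their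
-- squares. Applying 2x ≤ 1 + x² to these numbers is a linearised Cauchy-Schwarz inequality, whose
-- additive form can be averaged over `J` at once. The numbers need not be 0 or 1, which is why the
-- induction runs over all real functions vanishing off V and not over indicators. The weight ℓ =
-- α/(1-α) is dictated by comparing coefficients when one coordinate is split into kept and dropped.
-- Spreadness then charges αp per element of I, and a coordinate is affordable as soon as ℓ · αp ≤
-- p, that is α² ≤ 1 - α; the golden bound is where this is an equality. In Strassen's theorem,
-- greedy transport could get stuck with mass left over. Keeping every remainder feasible prevents
-- this: a pair that admits no more mass is certified by an empty endpoint or by a tight downset
-- separating its ends, and such downsets can be united into a contradiction.

module OrderedField (ℝ : CompleteOrderedField) where
  open CompleteOrderedField ℝ public
  open RingProperties ring public using (-‿distribˡ-*; -‿distribʳ-*; -‿involutive)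

  module Solver = NaturalSolver commutativeSemiring

  private
    module ≤ = IsTotalOrder (NonStrict.isTotalOrder _≈_ _<_ isStrictTotalOrder)

  poset : Poset _ _ _
  poset = record { isPartialOrder = ≤.isPartialOrder }

  open ≤ public
    using () renaming (refl to ≤-refl; trans to ≤-trans; antisym to ≤-antisym; total to ≤-total)
  open PosetReasoning poset public

  -- Inequalities in an ordered field.

  ≤⇒≯ : ∀ {x y} → x ≤ y → ¬ (y < x)
  ≤⇒≯ (inj₁ x<y) y<x = <-irrefl refl (<-trans x<y y<x)
  ≤⇒≯ (inj₂ x≈y) y<x = <-irrefl (sym x≈y) y<x

  +-monoˡ-≤ : ∀ z {x y} → x ≤ y → x + z ≤ y + z
  +-monoˡ-≤ z (inj₁ x<y) = inj₁ (+-monoˡ-< z x<y)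
  +-monoˡ-≤ z (inj₂ x≈y) = inj₂ (+-congʳ x≈y)

  +-monoʳ-≤ : ∀ z {x y} → x ≤ y → z + x ≤ z + y
  +-monoʳ-≤ z {x} {y} x≤y = begin
    z + x ≈⟨ +-comm z x ⟩
    x + z ≤⟨ +-monoˡ-≤ z x≤y ⟩
    y + z ≈⟨ +-comm y z ⟩
    z + y ∎

  +-mono-≤ : ∀ {x y u v} → x ≤ y → u ≤ v → x + u ≤ y + v
  +-mono-≤ {y = y} {u = u} x≤y u≤v = ≤-trans (+-monoˡ-≤ u x≤y) (+-monoʳ-≤ y u≤v)

  [x+z]-z≈x : ∀ x z → (x + z) - z ≈ x
  [x+z]-z≈x x z = begin-equality
    (x + z) - z   ≈⟨ +-assoc x z (- z) ⟩
    x + (z - z)   ≈⟨ +-congˡ (-‿inverseʳ z) ⟩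
    x + 0#        ≈⟨ +-identityʳ x ⟩
    x             ∎

  x+[y-x]≈y : ∀ x y → x + (y - x) ≈ y
  x+[y-x]≈y x y = begin-equality
    x + (y - x)   ≈⟨ +-assoc x y (- x) ⟨
    (x + y) - x   ≈⟨ +-congʳ (+-comm x y) ⟩
    (y + x) - x   ≈⟨ [x+z]-z≈x y x ⟩
    y             ∎

  +-cancelʳ-≤ : ∀ z {x y} → x + z ≤ y + z → x ≤ y
  +-cancelʳ-≤ z {x} {y} x+z≤y+z = begin
    x             ≈⟨ [x+z]-z≈x x z ⟨
    (x + z) - z   ≤⟨ +-monoˡ-≤ (- z) x+z≤y+z ⟩
    (y + z) - z   ≈⟨ [x+z]-z≈x y z ⟩
    y             ∎

  x≤y⇒0≤y-x : ∀ {x y} → x ≤ y → 0# ≤ y - x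
  x≤y⇒0≤y-x {x} {y} x≤y = begin
    0#      ≈⟨ -‿inverseʳ x ⟨
    x - x   ≤⟨ +-monoˡ-≤ (- x) x≤y ⟩
    y - x   ∎

  x≤x+y : ∀ x {y} → 0# ≤ y → x ≤ x + y
  x≤x+y x {y} 0≤y = begin
    x        ≈⟨ +-identityʳ x ⟨
    x + 0#   ≤⟨ +-monoʳ-≤ x 0≤y ⟩
    x + y    ∎

  +-nonneg : ∀ {x y} → 0# ≤ x → 0# ≤ y → 0# ≤ x + y
  +-nonneg {x} 0≤x 0≤y = ≤-trans 0≤x (x≤x+y x 0≤y)

  *-nonneg : ∀ {x y} → 0# ≤ x → 0# ≤ y → 0# ≤ x * y
  *-nonneg (inj₁ 0<x) (inj₁ 0<y) = inj₁ (*-pos 0<x 0<y)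
  *-nonneg {x} {y} (inj₂ 0≈x) _  = inj₂ (trans (sym (zeroˡ y)) (*-congʳ 0≈x))
  *-nonneg {x} {y} _  (inj₂ 0≈y) = inj₂ (trans (sym (zeroʳ x)) (*-congˡ 0≈y))

  *-monoˡ-≤ : ∀ {z x y} → 0# ≤ z → x ≤ y → z * x ≤ z * y
  *-monoˡ-≤ {z} {x} {y} 0≤z x≤y = begin
    z * x                 ≤⟨ x≤x+y _ (*-nonneg 0≤z (x≤y⇒0≤y-x x≤y)) ⟩
    z * x + z * (y - x)   ≈⟨ distribˡ z x (y - x) ⟨
    z * (x + (y - x))     ≈⟨ *-congˡ (x+[y-x]≈y x y) ⟩
    z * y                 ∎

  *-monoʳ-≤ : ∀ {z x y} → 0# ≤ z → x ≤ y → x * z ≤ y * z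
  *-monoʳ-≤ {z} {x} {y} 0≤z x≤y = begin
    x * z ≈⟨ *-comm x z ⟩
    z * x ≤⟨ *-monoˡ-≤ 0≤z x≤y ⟩
    z * y ≈⟨ *-comm z y ⟩
    y * z ∎

  0≤1 : 0# ≤ 1#
  0≤1 = inj₁ 0<1

  square-nonneg : ∀ x → 0# ≤ x * x
  square-nonneg x with ≤-total 0# x
  ... | inj₁ 0≤x = *-nonneg 0≤x 0≤x
  ... | inj₂ x≤0 = begin
    0#            ≤⟨ *-nonneg 0≤-x 0≤-x ⟩
    - x * - x     ≈⟨ -‿distribˡ-* x (- x) ⟨
    - (x * - x)   ≈⟨ -‿cong (-‿distribʳ-* x x) ⟨
    - - (x * x)   ≈⟨ -‿involutive (x * x) ⟩
    x * x         ∎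
    where
    0≤-x : 0# ≤ - x
    0≤-x = ≤-trans (x≤y⇒0≤y-x x≤0) (inj₂ (+-identityˡ (- x)))

-- Sums over subsets and expectations under the product measure.

module Sums (ℝ : CompleteOrderedField) where
  open OrderedField ℝ public
  open RandomSets ℝ public
  open Solver

  ∑-cong : ∀ n {f g : Subset n → Carrier} → (∀ A → f A ≈ g A) → ∑ f ≈ ∑ g
  ∑-cong zero    f≈g = f≈g []
  ∑-cong (suc n) f≈g = +-cong (∑-cong n (f≈g ∘ (outside ∷_))) (∑-cong n (f≈g ∘ (inside ∷_)))

  ∑-mono : ∀ n {f g : Subset n → Carrier} → (∀ A → f A ≤ g A) → ∑ f ≤ ∑ g
  ∑-mono zero    f≤g = f≤g []
  ∑-mono (suc n) f≤g = +-mono-≤ (∑-mono n (f≤g ∘ (outside ∷_))) (∑-mono n (f≤g ∘ (inside ∷_)))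

  ∑-zero : ∀ n {f : Subset n → Carrier} → (∀ A → f A ≈ 0#) → ∑ f ≈ 0#
  ∑-zero zero    f≈0 = f≈0 []
  ∑-zero (suc n) f≈0 =
    trans (+-cong (∑-zero n (f≈0 ∘ (outside ∷_))) (∑-zero n (f≈0 ∘ (inside ∷_)))) (+-identityˡ 0#)

  ∑-nonneg : ∀ n {f : Subset n → Carrier} → (∀ A → 0# ≤ f A) → 0# ≤ ∑ f
  ∑-nonneg zero    0≤f = 0≤f []
  ∑-nonneg (suc n) 0≤f =
    +-nonneg (∑-nonneg n (0≤f ∘ (outside ∷_))) (∑-nonneg n (0≤f ∘ (inside ∷_)))

  ∑-+ : ∀ n (f g : Subset n → Carrier) → ∑ (λ A → f A + g A) ≈ ∑ f + ∑ g
  ∑-+ zero    f g = refl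
  ∑-+ (suc n) f g = begin-equality
    ∑ (λ A → f₀ A + g₀ A) + ∑ (λ A → f₁ A + g₁ A)
      ≈⟨ +-cong (∑-+ n f₀ g₀) (∑-+ n f₁ g₁) ⟩
    (∑ f₀ + ∑ g₀) + (∑ f₁ + ∑ g₁)
      ≈⟨ solve 4 (λ a b c d → (a :+ b) :+ (c :+ d) := (a :+ c) :+ (b :+ d)) refl
           (∑ f₀) (∑ g₀) (∑ f₁) (∑ g₁) ⟩
    (∑ f₀ + ∑ f₁) + (∑ g₀ + ∑ g₁) ∎
    where
    f₀ = f ∘ (outside ∷_)
    f₁ = f ∘ (inside ∷_)
    g₀ = g ∘ (outside ∷_)
    g₁ = g ∘ (inside ∷_)

  ∑-*ˡ : ∀ n c (f : Subset n → Carrier) → ∑ (λ A → c * f A) ≈ c * ∑ f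
  ∑-*ˡ zero    c f = refl
  ∑-*ˡ (suc n) c f =
    trans (+-cong (∑-*ˡ n c (f ∘ (outside ∷_))) (∑-*ˡ n c (f ∘ (inside ∷_)))) (sym (distribˡ c _ _))

  ∑-*ʳ : ∀ n c (f : Subset n → Carrier) → ∑ (λ A → f A * c) ≈ ∑ f * c
  ∑-*ʳ n c f = trans (∑-cong n λ A → *-comm (f A) c) (trans (∑-*ˡ n c f) (*-comm c (∑ f)))

  ∑-swap : ∀ m n (f : Subset m → Subset n → Carrier) →
           ∑ (λ A → ∑ (f A)) ≈ ∑ (λ B → ∑ (λ A → f A B))
  ∑-swap zero    n f = refl
  ∑-swap (suc m) n f =
    trans (+-cong (∑-swap m n f₀) (∑-swap m n f₁))
          (sym (∑-+ n (λ B → ∑ (λ A → f₀ A B)) (λ B → ∑ (λ A → f₁ A B))))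
    where
    f₀ = f ∘ (outside ∷_)
    f₁ = f ∘ (inside ∷_)

  ∑-single : ∀ {n} {f : Subset n → Carrier} A → (∀ B → B ≢ A → f B ≈ 0#) → ∑ f ≈ f A
  ∑-single                 []            f≈0 = refl
  ∑-single {suc n} {f} (outside ∷ A) f≈0 =
    trans (+-cong (∑-single {f = f ∘ (outside ∷_)} A
                     λ B B≢A → f≈0 (outside ∷ B) λ { ≡.refl → B≢A ≡.refl })
                  (∑-zero n λ B → f≈0 (inside ∷ B) λ ()))
          (+-identityʳ _)
  ∑-single {suc n} {f} (inside ∷ A)  f≈0 =
    trans (+-cong (∑-zero n λ B → f≈0 (outside ∷ B) λ ())
                  (∑-single {f = f ∘ (inside ∷_)} A
                     λ B B≢A → f≈0 (inside ∷ B) λ { ≡.refl → B≢A ≡.refl }))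
          (+-identityˡ _)

  𝟙 : Bool → Carrier
  𝟙 b = if b then 1# else 0#

  0≤𝟙 : ∀ b → 0# ≤ 𝟙 b
  0≤𝟙 true  = 0≤1
  0≤𝟙 false = ≤-refl

  𝟙-idem : ∀ b → 𝟙 b * 𝟙 b ≈ 𝟙 b
  𝟙-idem true  = *-identityˡ 1#
  𝟙-idem false = zeroˡ 0#

  𝔼 : ∀ n → Carrier → (Subset n → Carrier) → Carrier
  𝔼 n s h = ∑ λ A → μ s A * h A

  𝔼-cong : ∀ n s {h k : Subset n → Carrier} → (∀ A → h A ≈ k A) → 𝔼 n s h ≈ 𝔼 n s k
  𝔼-cong n s h≈k = ∑-cong n λ A → *-congˡ (h≈k A)

  𝔼-+ : ∀ n s (h k : Subset n → Carrier) → 𝔼 n s (λ A → h A + k A) ≈ 𝔼 n s h + 𝔼 n s k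
  𝔼-+ n s h k = trans (∑-cong n λ A → distribˡ (μ s A) (h A) (k A))
                      (∑-+ n (λ A → μ s A * h A) (λ A → μ s A * k A))

  𝔼-*ˡ : ∀ n s c (h : Subset n → Carrier) → 𝔼 n s (λ A → c * h A) ≈ c * 𝔼 n s h
  𝔼-*ˡ n s c h = trans
    (∑-cong n λ A → solve 3 (λ m c h → m :* (c :* h) := c :* (m :* h)) refl (μ s A) c (h A))
    (∑-*ˡ n c λ A → μ s A * h A)

  μ-outside : ∀ {n} s (A : Subset n) → μ s (outside ∷ A) ≈ (1# - s) * μ s A
  -- `suc n ∸ ∣ A ∣` is the successor of `n ∸ ∣ A ∣` only because ∣ A ∣ ≤ n; this yields the extra
  -- factor 1 - s.
  μ-outside {n} s A rewrite ℕ.+-∸-assoc 1 (Sub.∣p∣≤n A) =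
    solve 3 (λ x y z → x :* (y :* z) := y :* (x :* z)) refl
      (s ^ ∣ A ∣) (1# - s) ((1# - s) ^ (n ℕ.∸ ∣ A ∣))

  μ-inside : ∀ {n} s (A : Subset n) → μ s (inside ∷ A) ≈ s * μ s A
  μ-inside s A = *-assoc _ _ _

  𝔼-suc : ∀ n s (h : Subset (suc n) → Carrier) →
          𝔼 (suc n) s h ≈ (1# - s) * 𝔼 n s (h ∘ (outside ∷_)) + s * 𝔼 n s (h ∘ (inside ∷_))
  𝔼-suc n s h = +-cong
    (trans (∑-cong n λ A → trans (*-congʳ (μ-outside s A)) (*-assoc _ _ (h (outside ∷ A))))
           (∑-*ˡ n _ λ A → μ s A * h (outside ∷ A)))
    (trans (∑-cong n λ A → trans (*-congʳ (μ-inside s A)) (*-assoc _ _ (h (inside ∷ A))))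
           (∑-*ˡ n _ λ A → μ s A * h (inside ∷ A)))

  1-x+x≈1 : ∀ x → (1# - x) + x ≈ 1#
  1-x+x≈1 x = trans (+-comm _ x) (x+[y-x]≈y x 1#)

  μ-total : ∀ n s → ∑ (μ {n} s) ≈ 1#
  μ-total zero    s = *-identityˡ 1#
  μ-total (suc n) s = begin-equality
    ∑ (λ (A : Subset n) → μ s (outside ∷ A)) + ∑ (λ (A : Subset n) → μ s (inside ∷ A))
      ≈⟨ +-cong (trans (∑-cong n (μ-outside s)) (∑-*ˡ n (1# - s) (μ s)))
                (trans (∑-cong n (μ-inside s)) (∑-*ˡ n s (μ s))) ⟩
    (1# - s) * ∑ (μ {n} s) + s * ∑ (μ {n} s)
      ≈⟨ distribʳ _ _ _ ⟨
    ((1# - s) + s) * ∑ (μ {n} s)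
      ≈⟨ *-cong (1-x+x≈1 s) (μ-total n s) ⟩
    1# * 1#
      ≈⟨ *-identityˡ 1# ⟩
    1# ∎

  ^-nonneg : ∀ {x} → 0# ≤ x → ∀ k → 0# ≤ x ^ k
  ^-nonneg 0≤x zero    = 0≤1
  ^-nonneg 0≤x (suc k) = *-nonneg 0≤x (^-nonneg 0≤x k)

  μ-nonneg : ∀ {n s} → 0# ≤ s → s ≤ 1# → ∀ (A : Subset n) → 0# ≤ μ s A
  μ-nonneg {n} 0≤s s≤1 A =
    *-nonneg (^-nonneg 0≤s ∣ A ∣) (^-nonneg (x≤y⇒0≤y-x s≤1) (n ℕ.∸ ∣ A ∣))

  𝔼-mono : ∀ n {s} → 0# ≤ s → s ≤ 1# → {h k : Subset n → Carrier} →
           (∀ A → h A ≤ k A) → 𝔼 n s h ≤ 𝔼 n s k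
  𝔼-mono n 0≤s s≤1 h≤k = ∑-mono n λ A → *-monoˡ-≤ (μ-nonneg 0≤s s≤1 A) (h≤k A)

-- The indicator of a downset. Boolean values let it weigh masses through `𝟙`, with `_∨_` and `_∧_`
-- as union and intersection.
Antitone : ∀ {n} → (Subset n → Bool) → Set
Antitone V = ∀ {A B} → A ⊆ B → V B ≡ true → V A ≡ true

antitone-section : ∀ {n} {V : Subset (suc n) → Bool} s → Antitone V → Antitone (V ∘ (s ∷_))
antitone-section s anti A⊆B = anti (Sub.s⊆s A⊆B)

-- Hence a function vanishing off V has both its sections zero wherever the `outside` section of V
-- is false, and so is every linear combination of them.
antitone-false : ∀ {n} {V : Subset (suc n) → Bool} → Antitone V →
                 ∀ {A} → V (outside ∷ A) ≡ false → V (inside ∷ A) ≡ false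
antitone-false {V = V} anti {A} V₀≡false = go (V (inside ∷ A)) ≡.refl
  where
  go : ∀ v → V (inside ∷ A) ≡ v → v ≡ false
  go false _ = ≡.refl
  go true  V₁≡true with ≡.trans (≡.sym V₀≡false) (anti (Sub.out⊆ Sub.⊆-refl) V₁≡true)
  ... | ()

-- The quadratic form and its two bounds.

-- With p-biased Fourier coefficients ĥ and ℓ = α/(1-α), Q J h is the sum over
-- I ⊆ J of (ℓ (1-p) / p)^|I| ĥ(I)²; `avg` and `diff` integrate out a coordinate
-- and take its discrete derivative.
module Certificate (ℝ : CompleteOrderedField) (p ℓ : CompleteOrderedField.Carrier ℝ) where
  open Sums ℝ
  open Solver

  b : Carrier
  b = 1# - p

  avg diff : ∀ {n} → (Subset (suc n) → Carrier) → Subset n → Carrier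
  avg  h A = b * h (outside ∷ A) + p * h (inside ∷ A)
  diff h A = b * h (outside ∷ A) + - b * h (inside ∷ A)

  Q : ∀ {n} → Subset n → (Subset n → Carrier) → Carrier
  Q []            h = h [] * h []
  Q (outside ∷ J) h = Q J (avg h)
  Q (inside ∷ J)  h = Q J (avg h) + ℓ * Q J (diff h)

  Q-cong : ∀ {n} (J : Subset n) {h k : Subset n → Carrier} → (∀ A → h A ≈ k A) → Q J h ≈ Q J k
  Q-cong []            h≈k = *-cong (h≈k []) (h≈k [])
  Q-cong (outside ∷ J) h≈k = Q-cong J λ A → +-cong (*-congˡ (h≈k _)) (*-congˡ (h≈k _))
  Q-cong (inside ∷ J)  h≈k = +-cong
    (Q-cong J λ A → +-cong (*-congˡ (h≈k _)) (*-congˡ (h≈k _)))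
    (*-congˡ (Q-cong J λ A → +-cong (*-congˡ (h≈k _)) (*-congˡ (h≈k _))))

  private
    -- Free coefficients cover both `avg`, with (b, p), and `diff`, with (b, - b); this is why
    -- `diff` carries `- b` as a coefficient.
    linear-+ : ∀ u v x₀ x₁ y₀ y₁ →
               u * (x₀ + y₀) + v * (x₁ + y₁) ≈ (u * x₀ + v * x₁) + (u * y₀ + v * y₁)
    linear-+ = solve 6 (λ u v x₀ x₁ y₀ y₁ →
      u :* (x₀ :+ y₀) :+ v :* (x₁ :+ y₁) := (u :* x₀ :+ v :* x₁) :+ (u :* y₀ :+ v :* y₁)) refl

    linear-+* : ∀ u v c x₀ x₁ y₀ y₁ → u * (x₀ + c * y₀) + v * (x₁ + c * y₁) ≈
                                      (u * x₀ + v * x₁) + c * (u * y₀ + v * y₁)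
    linear-+* = solve 7 (λ u v c x₀ x₁ y₀ y₁ → u :* (x₀ :+ c :* y₀) :+ v :* (x₁ :+ c :* y₁) :=
      (u :* x₀ :+ v :* x₁) :+ c :* (u :* y₀ :+ v :* y₁)) refl

    b+p≈1 : b + p ≈ 1#
    b+p≈1 = 1-x+x≈1 p

  module _ {a ā : Carrier} (ā+a≈1 : ā + a ≈ 1#) (ā[1+ℓ]≈1 : ā * (1# + ℓ) ≈ 1#) where

    -- Diagonalises Q on an element of J, so that `tangent` can split on whether
    -- the thinning keeps that element.
    Q-split : ∀ {n} (J : Subset n) (x y : Subset n → Carrier) →
              Q J (λ A → x A + y A) + ℓ * Q J y ≈
              ā * Q J (λ A → x A + (1# + ℓ) * y A) + a * Q J x
    Q-split [] x′ y′ = begin-equality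
      (x + y) * (x + y) + ℓ * (y * y)
        ≈⟨ solve 3 (λ x y ℓ → (x :+ y) :* (x :+ y) :+ ℓ :* (y :* y) :=
             con 1 :* (x :* x) :+ con 1 :* (x :* y :+ x :* y :+ (con 1 :+ ℓ) :* (y :* y)))
             refl x y ℓ ⟩
      -- The two units are exposed to become ā + a on x² and ā (1 + ℓ) on the remaining terms; these
      -- are the coefficient comparisons that determine ℓ.
      1# * (x * x) + 1# * (x * y + x * y + (1# + ℓ) * (y * y))
        ≈⟨ +-cong (*-congʳ ā+a≈1) (*-congʳ ā[1+ℓ]≈1) ⟨
      (ā + a) * (x * x) + ā * (1# + ℓ) * (x * y + x * y + (1# + ℓ) * (y * y))
        ≈⟨ solve 5 (λ x y g a ā →
             (ā :+ a) :* (x :* x) :+ ā :* g :* (x :* y :+ x :* y :+ g :* (y :* y)) :=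
             ā :* ((x :+ g :* y) :* (x :+ g :* y)) :+ a :* (x :* x)) refl x y (1# + ℓ) a ā ⟩
      ā * ((x + (1# + ℓ) * y) * (x + (1# + ℓ) * y)) + a * (x * x) ∎
      where
      x = x′ []
      y = y′ []
    Q-split (outside ∷ J) x y = begin-equality
      Q J (avg (λ A → x A + y A)) + ℓ * Q J (avg y)
        ≈⟨ +-congʳ (Q-cong J λ A → linear-+ b p _ _ _ _) ⟩
      Q J (λ A → avg x A + avg y A) + ℓ * Q J (avg y)
        ≈⟨ Q-split J (avg x) (avg y) ⟩
      ā * Q J (λ A → avg x A + (1# + ℓ) * avg y A) + a * Q J (avg x)
        ≈⟨ +-congʳ (*-congˡ (Q-cong J λ A → linear-+* b p (1# + ℓ) _ _ _ _)) ⟨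
      ā * Q J (avg (λ A → x A + (1# + ℓ) * y A)) + a * Q J (avg x) ∎
    Q-split (inside ∷ J) x y = begin-equality
      (Q J (avg (λ A → x A + y A)) + ℓ * Q J (diff (λ A → x A + y A)))
        + ℓ * (Q J (avg y) + ℓ * Q J (diff y))
        ≈⟨ +-congʳ (+-cong (Q-cong J λ A → linear-+ b p _ _ _ _)
             (*-congˡ (Q-cong J λ A → linear-+ b (- b) _ _ _ _))) ⟩
      (Q J (λ A → avg x A + avg y A) + ℓ * Q J (λ A → diff x A + diff y A))
        + ℓ * (Q J (avg y) + ℓ * Q J (diff y))
        ≈⟨ solve 5 (λ s t u v ℓ → (s :+ ℓ :* t) :+ ℓ :* (u :+ ℓ :* v) :=
             (s :+ ℓ :* u) :+ ℓ :* (t :+ ℓ :* v)) refl _ _ _ _ ℓ ⟩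
      -- Regrouped so that the induction hypothesis applies once to the averages and once to the
      -- derivatives.
      (Q J (λ A → avg x A + avg y A) + ℓ * Q J (avg y))
        + ℓ * (Q J (λ A → diff x A + diff y A) + ℓ * Q J (diff y))
        ≈⟨ +-cong (Q-split J (avg x) (avg y)) (*-congˡ (Q-split J (diff x) (diff y))) ⟩
      (ā * Q J (λ A → avg x A + (1# + ℓ) * avg y A) + a * Q J (avg x))
        + ℓ * (ā * Q J (λ A → diff x A + (1# + ℓ) * diff y A) + a * Q J (diff x))
        ≈⟨ +-cong (+-congʳ (*-congˡ (Q-cong J λ A → linear-+* b p (1# + ℓ) _ _ _ _)))
             (*-congˡ (+-congʳ (*-congˡ (Q-cong J λ A → linear-+* b (- b) (1# + ℓ) _ _ _ _)))) ⟨
      (ā * Q J (avg (λ A → x A + (1# + ℓ) * y A)) + a * Q J (avg x))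
        + ℓ * (ā * Q J (diff (λ A → x A + (1# + ℓ) * y A)) + a * Q J (diff x))
        ≈⟨ solve 7 (λ s t u v ℓ a ā → (ā :* s :+ a :* t) :+ ℓ :* (ā :* u :+ a :* v) :=
             ā :* (s :+ ℓ :* u) :+ a :* (t :+ ℓ :* v)) refl _ _ _ _ ℓ a ā ⟩
      ā * (Q J (avg (λ A → x A + (1# + ℓ) * y A)) + ℓ * Q J (diff (λ A → x A + (1# + ℓ) * y A)))
        + a * (Q J (avg x) + ℓ * Q J (diff x)) ∎

  𝔼-avg : ∀ n (h : Subset (suc n) → Carrier) → 𝔼 (suc n) p h ≈ 𝔼 n p (avg h)
  𝔼-avg n h = begin-equality
    𝔼 (suc n) p h
      ≈⟨ 𝔼-suc n p h ⟩
    b * 𝔼 n p (h ∘ (outside ∷_)) + p * 𝔼 n p (h ∘ (inside ∷_))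
      ≈⟨ +-cong (𝔼-*ˡ n p b (h ∘ (outside ∷_))) (𝔼-*ˡ n p p (h ∘ (inside ∷_))) ⟨
    𝔼 n p (λ A → b * h (outside ∷ A)) + 𝔼 n p (λ A → p * h (inside ∷ A))
      ≈⟨ 𝔼-+ n p (λ A → b * h (outside ∷ A)) (λ A → p * h (inside ∷ A)) ⟨
    𝔼 n p (avg h) ∎

  -- As b + p = 1, averaging moves the `inside` value by b times its gap to the `outside` value.
  -- This puts `avg h` in the form x + y, with y = `diff h`, that `Q-split` expects.
  avg≈inside+diff : ∀ {n} (h : Subset (suc n) → Carrier) A → avg h A ≈ h (inside ∷ A) + diff h A
  avg≈inside+diff h A = begin-equality
    b * h₀ + p * h₁                   ≈⟨ +-identityʳ _ ⟨
    (b * h₀ + p * h₁) + 0#            ≈⟨ +-congˡ (trans (*-congʳ (-‿inverseʳ b)) (zeroˡ h₁)) ⟨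
    (b * h₀ + p * h₁) + (b - b) * h₁  ≈⟨ solve 5 (λ b p c x y → (b :* x :+ p :* y) :+ (b :+ c) :* y
                                          := (b :+ p) :* y :+ (b :* x :+ c :* y)) refl b p (- b) h₀ h₁ ⟩
    (b + p) * h₁ + diff h A           ≈⟨ +-congʳ (trans (*-congʳ b+p≈1) (*-identityˡ h₁)) ⟩
    h₁ + diff h A                     ∎
    where
    h₀ = h (outside ∷ A)
    h₁ = h (inside ∷ A)

  module _ {a : Carrier} (0≤a : 0# ≤ a) (a≤1 : a ≤ 1#) (ā[1+ℓ]≈1 : (1# - a) * (1# + ℓ) ≈ 1#) where
    private
      ā = 1# - a

      0≤ā : 0# ≤ ā
      0≤ā = x≤y⇒0≤y-x a≤1

    x+x≤1+xx : ∀ x → x + x ≤ 1# + x * x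
    x+x≤1+xx x = begin
      x + x
        ≤⟨ x≤x+y (x + x) (square-nonneg d) ⟩
      (x + x) + d * d
        ≈⟨ +-congʳ (trans (*-congˡ (x+[y-x]≈y x 1#)) (*-identityʳ (x + x))) ⟨
      (x + x) * (x + d) + d * d
        ≈⟨ solve 2 (λ x d → (x :+ x) :* (x :+ d) :+ d :* d := (x :+ d) :* (x :+ d) :+ x :* x)
             refl x d ⟩
      (x + d) * (x + d) + x * x
        ≈⟨ +-congʳ (trans (*-cong (x+[y-x]≈y x 1#) (x+[y-x]≈y x 1#)) (*-identityˡ 1#)) ⟩
      1# + x * x ∎
      where d = 1# - x

    -- Induction on coordinates, with `h` generalised because the function that arises when the
    -- thinning drops an element of `J` is no indicator. A coordinate outside `J` is averaged out;
    -- one in `J` is split by `Q-split` into kept and dropped cases, each an instance for a section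
    -- of V. At the bottom it is 2x ≤ 1 + x² on V, and x = 0 off V.
    tangent : ∀ {n} (J : Subset n) {V : Subset n → Bool} → Antitone V →
              ∀ h → (∀ A → V A ≡ false → h A ≈ 0#) →
              𝔼 n p h + 𝔼 n p h ≤ 𝔼 n a (λ B → 𝟙 (V (J ∩ B))) + Q J h
    tangent [] {V} anti h h≈0 = begin
      1# * 1# * x + 1# * 1# * x
        ≈⟨ solve 1 (λ x → con 1 :* con 1 :* x :+ con 1 :* con 1 :* x := x :+ x) refl x ⟩
      x + x
        ≤⟨ go (V []) ≡.refl ⟩
      𝟙 (V []) + x * x
        ≈⟨ +-congʳ (solve 1 (λ x → con 1 :* con 1 :* x := x) refl (𝟙 (V []))) ⟨
      1# * 1# * 𝟙 (V []) + x * x ∎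
      where
      x = h []

      go : ∀ v → V [] ≡ v → x + x ≤ 𝟙 v + x * x
      go true  _ = x+x≤1+xx x
      go false V≡false = begin
        x + x        ≈⟨ +-congˡ (h≈0 [] V≡false) ⟩
        x + 0#       ≈⟨ +-identityʳ x ⟩
        x            ≈⟨ h≈0 [] V≡false ⟩
        0#           ≤⟨ square-nonneg x ⟩
        x * x        ≈⟨ +-identityˡ (x * x) ⟨
        0# + x * x   ∎
    tangent {suc n} (outside ∷ J) {V} anti h h≈0 = begin
      𝔼 (suc n) p h + 𝔼 (suc n) p h
        ≈⟨ +-cong (𝔼-avg n h) (𝔼-avg n h) ⟩
      𝔼 n p (avg h) + 𝔼 n p (avg h)
        ≤⟨ tangent J (antitone-section outside anti) (avg h) avg≈0 ⟩
      L + Q J (avg h)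
        ≈⟨ +-congʳ (trans (sym (*-identityˡ L)) (*-congʳ (sym (1-x+x≈1 a)))) ⟩
      (ā + a) * L + Q J (avg h)
        ≈⟨ +-congʳ (distribʳ L ā a) ⟩
      (ā * L + a * L) + Q J (avg h)
        ≈⟨ +-congʳ (𝔼-suc n a (λ B → 𝟙 (V ((outside ∷ J) ∩ B)))) ⟨
      𝔼 (suc n) a (λ B → 𝟙 (V ((outside ∷ J) ∩ B))) + Q J (avg h) ∎
      where
      L = 𝔼 n a (λ B → 𝟙 (V (outside ∷ (J ∩ B))))

      avg≈0 : ∀ A → V (outside ∷ A) ≡ false → avg h A ≈ 0#
      avg≈0 A V≡false = begin-equality
        b * h (outside ∷ A) + p * h (inside ∷ A)
          ≈⟨ +-cong (*-congˡ (h≈0 _ V≡false)) (*-congˡ (h≈0 _ (antitone-false anti V≡false))) ⟩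
        b * 0# + p * 0#
          ≈⟨ +-cong (zeroʳ b) (zeroʳ p) ⟩
        0# + 0#
          ≈⟨ +-identityˡ 0# ⟩
        0# ∎
    tangent {suc n} (inside ∷ J) {V} anti h h≈0 = begin
      𝔼 (suc n) p h + 𝔼 (suc n) p h
        ≈⟨ +-cong 𝔼h≈ 𝔼h≈ ⟩
      (ā * 𝔼 n p g + a * 𝔼 n p x) + (ā * 𝔼 n p g + a * 𝔼 n p x)
        ≈⟨ solve 4 (λ a ā g x → (ā :* g :+ a :* x) :+ (ā :* g :+ a :* x) :=
             ā :* (g :+ g) :+ a :* (x :+ x)) refl a ā (𝔼 n p g) (𝔼 n p x) ⟩
      ā * (𝔼 n p g + 𝔼 n p g) + a * (𝔼 n p x + 𝔼 n p x)
        ≤⟨ +-mono-≤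
             (*-monoˡ-≤ 0≤ā (tangent J (antitone-section outside anti) g g≈0))
             (*-monoˡ-≤ 0≤a (tangent J (antitone-section inside anti) x λ A → h≈0 (inside ∷ A))) ⟩
      ā * (L₀ + Q J g) + a * (L₁ + Q J x)
        ≈⟨ solve 6 (λ a ā s t u v → ā :* (s :+ t) :+ a :* (u :+ v) :=
             (ā :* s :+ a :* u) :+ (ā :* t :+ a :* v)) refl a ā L₀ (Q J g) L₁ (Q J x) ⟩
      (ā * L₀ + a * L₁) + (ā * Q J g + a * Q J x)
        ≈⟨ +-cong (𝔼-suc n a (λ B → 𝟙 (V ((inside ∷ J) ∩ B))))
             (trans (+-congʳ (Q-cong J (avg≈inside+diff h)))
                    (Q-split (1-x+x≈1 a) ā[1+ℓ]≈1 J x (diff h))) ⟨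
      𝔼 (suc n) a (λ B → 𝟙 (V ((inside ∷ J) ∩ B))) + (Q J (avg h) + ℓ * Q J (diff h)) ∎
      where
      x g : Subset n → Carrier
      x = h ∘ (inside ∷_)
      -- The solution of ā g + a x = avg h, since 1/ā = 1 + ℓ: if a kept element leaves `x`, a
      -- dropped one must leave `g` for the means to agree.
      g A = x A + (1# + ℓ) * diff h A

      L₀ = 𝔼 n a (λ B → 𝟙 (V (outside ∷ (J ∩ B))))
      L₁ = 𝔼 n a (λ B → 𝟙 (V (inside ∷ (J ∩ B))))

      g≈0 : ∀ A → V (outside ∷ A) ≡ false → g A ≈ 0#
      g≈0 A V≡false = begin-equality
        x A + (1# + ℓ) * (b * h (outside ∷ A) + - b * x A)
          ≈⟨ +-cong x≈0 (*-congˡ (+-cong (*-congˡ (h≈0 _ V≡false)) (*-congˡ x≈0))) ⟩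
        0# + (1# + ℓ) * (b * 0# + - b * 0#)
          ≈⟨ solve 3 (λ g b c → con 0 :+ g :* (b :* con 0 :+ c :* con 0) := con 0)
               refl (1# + ℓ) b (- b) ⟩
        0# ∎
        where
        x≈0 : x A ≈ 0#
        x≈0 = h≈0 _ (antitone-false anti V≡false)

      𝔼h≈ : 𝔼 (suc n) p h ≈ ā * 𝔼 n p g + a * 𝔼 n p x
      𝔼h≈ = begin-equality
        𝔼 (suc n) p h
          ≈⟨ 𝔼-avg n h ⟩
        𝔼 n p (avg h)
          ≈⟨ 𝔼-cong n p pointwise ⟩
        𝔼 n p (λ A → ā * g A + a * x A)
          ≈⟨ 𝔼-+ n p (λ A → ā * g A) (λ A → a * x A) ⟩
        𝔼 n p (λ A → ā * g A) + 𝔼 n p (λ A → a * x A)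
          ≈⟨ +-cong (𝔼-*ˡ n p ā g) (𝔼-*ˡ n p a x) ⟩
        ā * 𝔼 n p g + a * 𝔼 n p x ∎
        where
        pointwise : ∀ A → avg h A ≈ ā * g A + a * x A
        pointwise A = begin-equality
          avg h A
            ≈⟨ avg≈inside+diff h A ⟩
          x A + diff h A
            ≈⟨ +-cong (*-identityˡ (x A)) (*-identityˡ (diff h A)) ⟨
          1# * x A + 1# * diff h A
            ≈⟨ +-cong (*-congʳ (1-x+x≈1 a)) (*-congʳ ā[1+ℓ]≈1) ⟨
          (ā + a) * x A + ā * (1# + ℓ) * diff h A
            ≈⟨ solve 5 (λ a ā c x d → (ā :+ a) :* x :+ ā :* c :* d :=
                 ā :* (x :+ c :* d) :+ a :* x) refl a ā (1# + ℓ) (x A) (diff h A) ⟩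
          ā * (x A + (1# + ℓ) * diff h A) + a * x A ∎

  module _ (0≤p : 0# ≤ p) (p≤1 : p ≤ 1#) (0≤ℓ : 0# ≤ ℓ) {q : Carrier} (0≤q : 0# ≤ q)
           (ℓq≤p : ℓ * q ≤ p) where
    private
      0≤b : 0# ≤ b
      0≤b = x≤y⇒0≤y-x p≤1

      b≤1 : b ≤ 1#
      b≤1 = begin
        b       ≤⟨ x≤x+y b 0≤p ⟩
        b + p   ≈⟨ b+p≈1 ⟩
        1#      ∎

    -- Parseval for one coordinate: the mean square is the squared mean plus the variance p b d²,
    -- with d the gap between the two values. As `diff` is b d, the second term is ℓ q b² d² ≤ p b²
    -- d² ≤ p b d².
    avg²+diff² : ∀ {n} (h : Subset (suc n) → Carrier) A →
                 avg h A * avg h A + ℓ * q * (diff h A * diff h A) ≤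
                 b * (h (outside ∷ A) * h (outside ∷ A)) + p * (h (inside ∷ A) * h (inside ∷ A))
    avg²+diff² h A = begin
      avg h A * avg h A + ℓ * q * (diff h A * diff h A)
        ≈⟨ +-cong (*-cong avg≈ avg≈) (*-congˡ (*-cong diff≈ diff≈)) ⟩
      (x + b * d) * (x + b * d) + ℓ * q * (b * d * (b * d))
        ≤⟨ +-monoʳ-≤ _ (*-monoʳ-≤ (square-nonneg (b * d)) ℓq≤p) ⟩
      (x + b * d) * (x + b * d) + p * (b * d * (b * d))
        ≈⟨ +-congˡ (solve 3 (λ p b d → p :* (b :* d :* (b :* d)) := b :* (p :* b :* (d :* d)))
             refl p b d) ⟩
      (x + b * d) * (x + b * d) + b * (p * b * (d * d))
        ≤⟨ +-monoʳ-≤ _ (*-monoʳ-≤ (*-nonneg (*-nonneg 0≤p 0≤b) (square-nonneg d)) b≤1) ⟩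
      (x + b * d) * (x + b * d) + 1# * (p * b * (d * d))
        ≈⟨ +-cong (*-cong 1x≈ 1x≈) (sym (*-identityˡ _)) ⟨
      -- The factor b + p makes the next identity homogeneous, hence valid for independent b and p.
      ((b + p) * x + b * d) * ((b + p) * x + b * d) + p * b * (d * d)
        ≈⟨ solve 4 (λ p b x d →
             ((b :+ p) :* x :+ b :* d) :* ((b :+ p) :* x :+ b :* d) :+ p :* b :* (d :* d) :=
             (b :+ p) :* (b :* ((x :+ d) :* (x :+ d)) :+ p :* (x :* x))) refl p b x d ⟩
      (b + p) * (b * ((x + d) * (x + d)) + p * (x * x))
        ≈⟨ trans (*-congʳ b+p≈1) (*-identityˡ _) ⟩
      b * ((x + d) * (x + d)) + p * (x * x)
        ≈⟨ +-congʳ (*-congˡ (*-cong (x+[y-x]≈y x y) (x+[y-x]≈y x y))) ⟩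
      b * (y * y) + p * (x * x) ∎
      where
      x = h (inside ∷ A)
      y = h (outside ∷ A)
      d = y - x

      diff≈ : diff h A ≈ b * d
      diff≈ = begin-equality
        b * y + - b * x     ≈⟨ +-congˡ (-‿distribˡ-* b x) ⟨
        b * y + - (b * x)   ≈⟨ +-congˡ (-‿distribʳ-* b x) ⟩
        b * y + b * - x     ≈⟨ distribˡ b y (- x) ⟨
        b * (y - x)         ∎

      avg≈ : avg h A ≈ x + b * d
      avg≈ = trans (avg≈inside+diff h A) (+-congˡ diff≈)

      1x≈ : (b + p) * x + b * d ≈ x + b * d
      1x≈ = +-congʳ (trans (*-congʳ b+p≈1) (*-identityˡ x))

    -- The factor `c` makes the bound inductive: `ν₁`, the part of the law containing the first
    -- element, satisfies it with `c * q`, and `ν₀ + ν₁`, which forgets that element, with `c`. Only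
    -- `ν₁` meets the derivative, whose square thus acquires the weight ℓ q that `avg²+diff²`
    -- absorbs.
    Q-spread : ∀ n c → 0# ≤ c → (ν : Law n) → (∀ I → Pr ν (I ⊆?_) ≤ c * q ^ ∣ I ∣) →
               ∀ h → ∑ (λ J → ν J * Q J h) ≤ c * 𝔼 n p (λ A → h A * h A)
    Q-spread zero c 0≤c ν spread h = begin
      ν [] * (h [] * h [])
        ≤⟨ *-monoʳ-≤ (square-nonneg (h [])) (spread []) ⟩
      c * 1# * (h [] * h [])
        ≈⟨ solve 2 (λ c x → c :* con 1 :* x := c :* (con 1 :* con 1 :* x)) refl c (h [] * h []) ⟩
      c * (1# * 1# * (h [] * h [])) ∎
    Q-spread (suc n) c 0≤c ν spread h = begin
      ∑ (λ J → ν₀ J * Q J (avg h)) + ∑ (λ J → ν₁ J * (Q J (avg h) + ℓ * Q J (diff h)))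
        ≈⟨ ∑-+ n (λ J → ν₀ J * Q J (avg h)) (λ J → ν₁ J * (Q J (avg h) + ℓ * Q J (diff h))) ⟨
      ∑ (λ J → ν₀ J * Q J (avg h) + ν₁ J * (Q J (avg h) + ℓ * Q J (diff h)))
        ≈⟨ ∑-cong n (λ J → solve 5 (λ u v s t ℓ → u :* s :+ v :* (s :+ ℓ :* t) :=
             (u :+ v) :* s :+ ℓ :* (v :* t)) refl (ν₀ J) (ν₁ J) (Q J (avg h)) (Q J (diff h)) ℓ) ⟩
      ∑ (λ J → (ν₀ J + ν₁ J) * Q J (avg h) + ℓ * (ν₁ J * Q J (diff h)))
        ≈⟨ ∑-+ n (λ J → (ν₀ J + ν₁ J) * Q J (avg h)) (λ J → ℓ * (ν₁ J * Q J (diff h))) ⟩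
      ∑ (λ J → (ν₀ J + ν₁ J) * Q J (avg h)) + ∑ (λ J → ℓ * (ν₁ J * Q J (diff h)))
        ≈⟨ +-congˡ (∑-*ˡ n ℓ (λ J → ν₁ J * Q J (diff h))) ⟩
      ∑ (λ J → (ν₀ J + ν₁ J) * Q J (avg h)) + ℓ * ∑ (λ J → ν₁ J * Q J (diff h))
        ≤⟨ +-mono-≤ (Q-spread n c 0≤c (λ J → ν₀ J + ν₁ J) spread₀₁ (avg h))
             (*-monoˡ-≤ 0≤ℓ (Q-spread n (c * q) (*-nonneg 0≤c 0≤q) ν₁ spread₁ (diff h))) ⟩
      c * 𝔼 n p avg² + ℓ * (c * q * 𝔼 n p diff²)
        ≈⟨ solve 5 (λ c q ℓ s t → c :* s :+ ℓ :* (c :* q :* t) := c :* (s :+ ℓ :* q :* t))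
             refl c q ℓ (𝔼 n p avg²) (𝔼 n p diff²) ⟩
      c * (𝔼 n p avg² + ℓ * q * 𝔼 n p diff²)
        ≈⟨ *-congˡ (+-congˡ (𝔼-*ˡ n p (ℓ * q) diff²)) ⟨
      c * (𝔼 n p avg² + 𝔼 n p (λ A → ℓ * q * diff² A))
        ≈⟨ *-congˡ (𝔼-+ n p avg² (λ A → ℓ * q * diff² A)) ⟨
      c * 𝔼 n p (λ A → avg² A + ℓ * q * diff² A)
        ≤⟨ *-monoˡ-≤ 0≤c (𝔼-mono n 0≤p p≤1 (avg²+diff² h)) ⟩
      c * 𝔼 n p (avg (λ A → h A * h A))
        ≈⟨ *-congˡ (𝔼-avg n (λ A → h A * h A)) ⟨
      c * 𝔼 (suc n) p (λ A → h A * h A) ∎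
      where
      ν₀ ν₁ avg² diff² : Subset n → Carrier
      ν₀ = ν ∘ (outside ∷_)
      ν₁ = ν ∘ (inside ∷_)
      avg² A = avg h A * avg h A
      diff² A = diff h A * diff h A

      if-+ : ∀ s x y → (if s then x + y else 0#) ≈ (if s then x else 0#) + (if s then y else 0#)
      if-+ true  x y = refl
      if-+ false x y = sym (+-identityˡ 0#)

      spread₀₁ : ∀ I → Pr (λ J → ν₀ J + ν₁ J) (I ⊆?_) ≤ c * q ^ ∣ I ∣
      spread₀₁ I = begin
        Pr (λ J → ν₀ J + ν₁ J) (I ⊆?_)
          ≈⟨ ∑-cong n (λ J → if-+ (does (I ⊆? J)) (ν₀ J) (ν₁ J)) ⟩
        ∑ (λ J → (if does (I ⊆? J) then ν₀ J else 0#) + (if does (I ⊆? J) then ν₁ J else 0#))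
          ≈⟨ ∑-+ n (λ J → if does (I ⊆? J) then ν₀ J else 0#)
                   (λ J → if does (I ⊆? J) then ν₁ J else 0#) ⟩
        Pr ν ((outside ∷ I) ⊆?_)
          ≤⟨ spread (outside ∷ I) ⟩
        c * q ^ ∣ I ∣ ∎

      spread₁ : ∀ I → Pr ν₁ (I ⊆?_) ≤ c * q * q ^ ∣ I ∣
      spread₁ I = begin
        Pr ν₁ (I ⊆?_)
          ≈⟨ +-identityˡ _ ⟨
        0# + Pr ν₁ (I ⊆?_)
          ≈⟨ +-congʳ (∑-zero n λ _ → refl) ⟨
        Pr ν ((inside ∷ I) ⊆?_)
          ≤⟨ spread (inside ∷ I) ⟩
        c * (q * q ^ ∣ I ∣)
          ≈⟨ *-assoc c q _ ⟨
        c * q * q ^ ∣ I ∣ ∎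

-- Finite enumeration of subsets and downsets.

subsets : ∀ n → List (Subset n)
subsets zero    = [] ∷ []
subsets (suc n) = map (outside ∷_) (subsets n) ++ map (inside ∷_) (subsets n)

∈-subsets : ∀ {n} (A : Subset n) → A ∈ subsets n
∈-subsets []            = here ≡.refl
∈-subsets (outside ∷ A) = ∈-++⁺ˡ (∈-map⁺ (outside ∷_) (∈-subsets A))
∈-subsets (inside ∷ A)  = ∈-++⁺ʳ (map (outside ∷_) (subsets _)) (∈-map⁺ (inside ∷_) (∈-subsets A))

-- The section over `inside` is cut down to the one over `outside`, which makes
-- every combination antitone and changes no function that already is.
glue : ∀ {n} → (Subset n → Bool) → (Subset n → Bool) → Subset (suc n) → Bool
glue V W (outside ∷ A) = V A
glue V W (inside ∷ A)  = V A ∧ W A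

antitones : ∀ n → List (Subset n → Bool)
antitones zero    = const true ∷ const false ∷ []
antitones (suc n) = cartesianProductWith glue (antitones n) (antitones n)

∧-true⁻ : ∀ x {y} → x ∧ y ≡ true → x ≡ true × y ≡ true
∧-true⁻ true y≡true = ≡.refl , y≡true

∧-true⁺ : ∀ {x y} → x ≡ true → y ≡ true → x ∧ y ≡ true
∧-true⁺ ≡.refl y≡true = y≡true

∨-true⁻ : ∀ x {y} → x ∨ y ≡ true → x ≡ true ⊎ y ≡ true
∨-true⁻ true  _      = inj₁ ≡.refl
∨-true⁻ false y≡true = inj₂ y≡true

∨-true⁺ˡ : ∀ {x} y → x ≡ true → x ∨ y ≡ true
∨-true⁺ˡ y ≡.refl = ≡.refl

∨-true⁺ʳ : ∀ x {y} → y ≡ true → x ∨ y ≡ true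
∨-true⁺ʳ true  _      = ≡.refl
∨-true⁺ʳ false y≡true = y≡true

glue-antitone : ∀ {n} {V W : Subset n → Bool} → Antitone V → Antitone W → Antitone (glue V W)
glue-antitone antiV antiW {outside ∷ A} {outside ∷ B} A⊆B = antiV (Sub.drop-∷-⊆ A⊆B)
glue-antitone antiV antiW {inside ∷ A}  {outside ∷ B} A⊆B with () ← A⊆B Vec.here
glue-antitone {V = V} antiV antiW {outside ∷ A} {inside ∷ B} A⊆B =
  antiV (Sub.drop-∷-⊆ A⊆B) ∘ proj₁ ∘ ∧-true⁻ (V B)
glue-antitone {V = V} antiV antiW {inside ∷ A} {inside ∷ B} A⊆B VW≡true with ∧-true⁻ (V B) VW≡true
... | VB , WB = ∧-true⁺ (antiV (Sub.drop-∷-⊆ A⊆B) VB) (antiW (Sub.drop-∷-⊆ A⊆B) WB)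

∈-antitones⁻ : ∀ n {V} → V ∈ antitones n → Antitone V
∈-antitones⁻ zero    (here ≡.refl)         _ _ = ≡.refl
∈-antitones⁻ zero    (there (here ≡.refl)) _ ()
∈-antitones⁻ (suc n) V∈ with ∈-cartesianProductWith⁻ glue (antitones n) (antitones n) V∈
... | V , W , V∈′ , W∈′ , ≡.refl = glue-antitone (∈-antitones⁻ n V∈′) (∈-antitones⁻ n W∈′)

-- The list is complete only up to pointwise equality of functions; `mass-congʳ` carries masses
-- across.
∈-antitones⁺ : ∀ n {V} → Antitone V → ∃[ W ] W ∈ antitones n × (∀ A → V A ≡ W A)
∈-antitones⁺ zero {V} anti = go (V []) ≡.refl
  where
  go : ∀ v → V [] ≡ v → ∃[ W ] W ∈ antitones zero × (∀ A → V A ≡ W A)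
  go true  eq = const true  , here ≡.refl         , λ { [] → eq }
  go false eq = const false , there (here ≡.refl) , λ { [] → eq }
∈-antitones⁺ (suc n) {V} anti
  with ∈-antitones⁺ n (antitone-section outside anti) | ∈-antitones⁺ n (antitone-section inside anti)
... | W₀ , W₀∈ , V≡W₀ | W₁ , W₁∈ , V≡W₁ = glue W₀ W₁ , ∈-cartesianProductWith⁺ glue W₀∈ W₁∈ , eq
  where
  cut : ∀ v₀ v₁ → (v₁ ≡ true → v₀ ≡ true) → v₁ ≡ v₀ ∧ v₁
  cut true  v₁    _   = ≡.refl
  cut false false _   = ≡.refl
  cut false true  imp with () ← imp ≡.refl

  eq : ∀ A → V A ≡ glue W₀ W₁ A
  eq (outside ∷ A) = V≡W₀ A
  eq (inside ∷ A)  = ≡.trans (cut _ _ (anti (Sub.out⊆ Sub.⊆-refl)))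
                             (≡.cong₂ _∧_ (V≡W₀ A) (V≡W₁ A))

-- Strassen's theorem for inclusion.

-- Mass is moved greedily along the pairs A ⊆ B, each time as much as keeps the
-- remainder feasible; a pair exhausted once stays exhausted.
module Strassen (ℝ : CompleteOrderedField) where
  open Sums ℝ
  open Solver

  mass : ∀ {n} → Law n → (Subset n → Bool) → Carrier
  mass ν V = ∑ λ A → ν A * 𝟙 (V A)

  δ : ∀ {n} → Subset n → Subset n → Carrier
  δ A X = 𝟙 (does (X ≟ˢ A))

  δ-self : ∀ {n} (A : Subset n) → δ A A ≡ 1#
  δ-self A = ≡.cong 𝟙 (dec-true (A ≟ˢ A) ≡.refl)

  δ-other : ∀ {n} {A X : Subset n} → X ≢ A → δ A X ≡ 0#
  δ-other {A = A} {X} X≢A = ≡.cong 𝟙 (dec-false (X ≟ˢ A) X≢A)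

  ∑-δ : ∀ {n} (c : Subset n → Carrier) A → ∑ (λ X → c X * δ A X) ≈ c A
  ∑-δ c A = trans
    (∑-single A λ X X≢A → trans (*-congˡ (reflexive (δ-other X≢A))) (zeroʳ (c X)))
    (trans (*-congˡ (reflexive (δ-self A))) (*-identityʳ (c A)))

  mass-congʳ : ∀ {n} (ν : Law n) {V W} → (∀ A → V A ≡ W A) → mass ν V ≈ mass ν W
  mass-congʳ {n} ν V≡W = ∑-cong n λ A → *-congˡ (reflexive (≡.cong 𝟙 (V≡W A)))

  mass-true : ∀ {n} (ν : Law n) → mass ν (const true) ≈ ∑ ν
  mass-true {n} ν = ∑-cong n λ A → *-identityʳ (ν A)

  mass-modular : ∀ {n} (ν : Law n) V W →
                 mass ν (λ A → V A ∨ W A) + mass ν (λ A → V A ∧ W A) ≈ mass ν V + mass ν W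
  mass-modular {n} ν V W = trans
    (sym (∑-+ n (λ A → ν A * 𝟙 (V A ∨ W A)) (λ A → ν A * 𝟙 (V A ∧ W A))))
    (trans (∑-cong n λ A → go (ν A) (V A) (W A)) (∑-+ n (λ A → ν A * 𝟙 (V A)) (λ A → ν A * 𝟙 (W A))))
    where
    go : ∀ x v w → x * 𝟙 (v ∨ w) + x * 𝟙 (v ∧ w) ≈ x * 𝟙 v + x * 𝟙 w
    go x true  w = refl
    go x false w = +-comm _ _

  mass-split : ∀ {n} {ν ν′ : Law n} {t A} → (∀ X → ν X ≈ ν′ X + t * δ A X) →
               ∀ V → mass ν V ≈ mass ν′ V + t * 𝟙 (V A)
  mass-split {n} {ν} {ν′} {t} {A} ν≈ V = begin-equality
    ∑ (λ X → ν X * 𝟙 (V X))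
      ≈⟨ ∑-cong n (λ X → trans (*-congʳ (ν≈ X)) (solve 4 (λ x t d v →
           (x :+ t :* d) :* v := x :* v :+ (t :* v) :* d) refl (ν′ X) t (δ A X) (𝟙 (V X)))) ⟩
    ∑ (λ X → ν′ X * 𝟙 (V X) + t * 𝟙 (V X) * δ A X)
      ≈⟨ ∑-+ n (λ X → ν′ X * 𝟙 (V X)) (λ X → t * 𝟙 (V X) * δ A X) ⟩
    mass ν′ V + ∑ (λ X → t * 𝟙 (V X) * δ A X)
      ≈⟨ +-congˡ (∑-δ (λ X → t * 𝟙 (V X)) A) ⟩
    mass ν′ V + t * 𝟙 (V A) ∎

  -- The invariant of the transport: Strassen's condition for the masses still to be matched.
  record Feasible {n} (a b : Law n) : Set where
    field
      a-nonneg : ∀ A → 0# ≤ a A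
      b-nonneg : ∀ B → 0# ≤ b B
      downset  : ∀ {V} → Antitone V → mass b V ≤ mass a V

  -- The reasons why no more mass can go from A to B: nothing left to send, nothing left to receive,
  -- or a tight V that would lose mass on the `a` side alone.
  Blocked : ∀ {n} → Law n → Law n → Subset n → Subset n → Set
  Blocked a b A B = a A ≈ 0# ⊎ b B ≈ 0# ⊎
    ∃[ V ] Antitone V × V A ≡ true × V B ≡ false × mass a V ≈ mass b V

  record Transport {n} (a b : Law n) : Set where
    field
      κ          : JointLaw n
      a′ b′      : Law n
      κ-nonneg   : ∀ A B → 0# ≤ κ A B
      κ-support  : ∀ A B → ¬ A ⊆ B → κ A B ≈ 0#
      a≈         : ∀ A → a A ≈ a′ A + law₁ κ A
      b≈         : ∀ B → b B ≈ b′ B + law₂ κ B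
      feasible   : Feasible a′ b′
      -- The surplus mass a V - mass b V never grows: whenever a received set lies in V, so does the
      -- smaller set it came from.
      slack      : ∀ {V} → Antitone V → mass a′ V + mass b V ≤ mass a V + mass b′ V

    open Feasible feasible

    law₁-nonneg : ∀ A → 0# ≤ law₁ κ A
    law₁-nonneg A = ∑-nonneg n (κ-nonneg A)

    law₂-nonneg : ∀ B → 0# ≤ law₂ κ B
    law₂-nonneg B = ∑-nonneg n λ A → κ-nonneg A B

    a′≤a : ∀ A → a′ A ≤ a A
    a′≤a A = ≤-trans (x≤x+y (a′ A) (law₁-nonneg A)) (inj₂ (sym (a≈ A)))

    b′≤b : ∀ B → b′ B ≤ b B
    b′≤b B = ≤-trans (x≤x+y (b′ B) (law₂-nonneg B)) (inj₂ (sym (b≈ B)))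

    -- Each kind of blocking is the vanishing of a quantity that transport only decreases and
    -- feasibility keeps nonnegative.
    blocked-persists : ∀ {A B} → Blocked a b A B → Blocked a′ b′ A B
    blocked-persists {A} (inj₁ a≈0) =
      inj₁ (≤-antisym (≤-trans (a′≤a A) (inj₂ a≈0)) (a-nonneg A))
    blocked-persists {_} {B} (inj₂ (inj₁ b≈0)) =
      inj₂ (inj₁ (≤-antisym (≤-trans (b′≤b B) (inj₂ b≈0)) (b-nonneg B)))
    blocked-persists (inj₂ (inj₂ (V , anti , V∋A , V∌B , tight))) =
      inj₂ (inj₂ (V , anti , V∋A , V∌B , ≤-antisym (+-cancelʳ-≤ (mass b V) le) (downset anti)))
      where
      le : mass a′ V + mass b V ≤ mass b′ V + mass b V
      le = begin
        mass a′ V + mass b V   ≤⟨ slack anti ⟩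
        mass a V + mass b′ V   ≈⟨ +-congʳ tight ⟩
        mass b V + mass b′ V   ≈⟨ +-comm _ _ ⟩
        mass b′ V + mass b V   ∎

  open Transport

  idle : ∀ {n} {a b : Law n} → Feasible a b → Transport a b
  idle {n} {a} {b} feas = record
    { κ         = λ _ _ → 0#
    ; a′        = a
    ; b′        = b
    ; κ-nonneg  = λ _ _ → ≤-refl
    ; κ-support = λ _ _ _ → refl
    ; a≈        = λ A → sym (trans (+-congˡ (∑-zero n λ _ → refl)) (+-identityʳ (a A)))
    ; b≈        = λ B → sym (trans (+-congˡ (∑-zero n λ _ → refl)) (+-identityʳ (b B)))
    ; feasible  = feas
    ; slack     = λ _ → ≤-refl
    }

  _⨾_ : ∀ {n} {a b : Law n} (T : Transport a b) → Transport (a′ T) (b′ T) → Transport a b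
  _⨾_ {n} {a} {b} T U = record
    { κ         = λ A B → κ T A B + κ U A B
    ; a′        = a′ U
    ; b′        = b′ U
    ; κ-nonneg  = λ A B → +-nonneg (κ-nonneg T A B) (κ-nonneg U A B)
    ; κ-support = λ A B A⊈B →
        trans (+-cong (κ-support T A B A⊈B) (κ-support U A B A⊈B)) (+-identityˡ 0#)
    ; a≈        = λ A → compose (a≈ T A) (a≈ U A) (∑-+ n (κ T A) (κ U A))
    ; b≈        = λ B → compose (b≈ T B) (b≈ U B) (∑-+ n (λ A → κ T A B) (λ A → κ U A B))
    ; feasible  = feasible U
    ; slack     = λ {V} anti → +-cancelʳ-≤ (mass (a′ T) V + mass (b′ T) V) (begin
        (mass (a′ U) V + mass b V) + (mass (a′ T) V + mass (b′ T) V)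
          ≈⟨ solve 4 (λ x y z w → (x :+ y) :+ (z :+ w) := (x :+ w) :+ (z :+ y)) refl _ _ _ _ ⟩
        (mass (a′ U) V + mass (b′ T) V) + (mass (a′ T) V + mass b V)
          ≤⟨ +-mono-≤ (slack U anti) (slack T anti) ⟩
        (mass (a′ T) V + mass (b′ U) V) + (mass a V + mass (b′ T) V)
          ≈⟨ solve 4 (λ x y z w → (x :+ y) :+ (z :+ w) := (z :+ y) :+ (x :+ w)) refl _ _ _ _ ⟩
        (mass a V + mass (b′ U) V) + (mass (a′ T) V + mass (b′ T) V) ∎)
    }
    where
    compose : ∀ {x y z u v w} → x ≈ y + u → y ≈ z + v → w ≈ u + v → x ≈ z + w
    compose {x} {y} {z} {u} {v} {w} x≈ y≈ w≈ = begin-equality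
      x             ≈⟨ x≈ ⟩
      y + u         ≈⟨ +-congʳ y≈ ⟩
      (z + v) + u   ≈⟨ solve 3 (λ z v u → (z :+ v) :+ u := z :+ (u :+ v)) refl z v u ⟩
      z + (u + v)   ≈⟨ +-congˡ w≈ ⟨
      z + w         ∎

  -- Where the minimum is attained matters as much as its value: that constraint is what blocks the
  -- pair.
  minimum : ∀ {Y : Set} (f : Y → Carrier) t₀ ys → (∀ y → y ∈ ys → 0# ≤ f y) → 0# ≤ t₀ →
            ∃[ t ] 0# ≤ t × t ≤ t₀ × (∀ y → y ∈ ys → t ≤ f y) ×
                   (t ≈ t₀ ⊎ ∃[ y ] y ∈ ys × t ≈ f y)
  minimum f t₀ []       0≤f 0≤t₀ = t₀ , 0≤t₀ , ≤-refl , (λ _ ()) , inj₁ refl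
  minimum f t₀ (y ∷ ys) 0≤f 0≤t₀
    with minimum f t₀ ys (λ z z∈ → 0≤f z (there z∈)) 0≤t₀
  ... | t , 0≤t , t≤t₀ , t≤f , attained with ≤-total t (f y)
  ...   | inj₁ t≤fy = t , 0≤t , t≤t₀
          , (λ { _ (here ≡.refl) → t≤fy ; z (there z∈) → t≤f z z∈ })
          , lift attained
          where
          lift : (t ≈ t₀ ⊎ ∃[ z ] z ∈ ys × t ≈ f z) → (t ≈ t₀ ⊎ ∃[ z ] z ∈ y ∷ ys × t ≈ f z)
          lift (inj₁ t≈t₀)          = inj₁ t≈t₀
          lift (inj₂ (z , z∈ , eq)) = inj₂ (z , there z∈ , eq)
  ...   | inj₂ fy≤t = f y , 0≤f y (here ≡.refl) , ≤-trans fy≤t t≤t₀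
          , (λ { _ (here ≡.refl) → ≤-refl ; z (there z∈) → ≤-trans fy≤t (t≤f z z∈) })
          , inj₂ (y , here ≡.refl , refl)

  min₂ : ∀ x y → ∃[ z ] z ≤ x × z ≤ y × (z ≈ x ⊎ z ≈ y)
  min₂ x y with ≤-total x y
  ... | inj₁ x≤y = x , ≤-refl , x≤y , inj₁ refl
  ... | inj₂ y≤x = y , y≤x , ≤-refl , inj₂ refl

  module _ {n} {a b : Law n} (feas : Feasible a b) {A B : Subset n} (A⊆B : A ⊆ B) where
    open Feasible feas

    -- The three upper bounds on t are what feasibility of the remainder demands. A downset
    -- containing both ends or neither keeps its surplus, and none contains B without A, so only
    -- those separating A from B constrain t.
    send : ∀ {t} → 0# ≤ t → t ≤ a A → t ≤ b B →
           (∀ {V} → Antitone V → V A ≡ true → V B ≡ false → mass b V + t ≤ mass a V) →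
           Transport a b
    send {t} 0≤t t≤a t≤b t≤slack = record
      { κ         = λ X Y → t * δ A X * δ B Y
      ; a′        = a⁻
      ; b′        = b⁻
      ; κ-nonneg  = λ X Y → *-nonneg (*-nonneg 0≤t (0≤𝟙 (does (X ≟ˢ A)))) (0≤𝟙 (does (Y ≟ˢ B)))
      ; κ-support = support
      ; a≈        = λ X → trans (a≈′ X) (+-congˡ (sym (∑-δ (λ _ → t * δ A X) B)))
      ; b≈        = λ Y → trans (b≈′ Y) (+-congˡ (sym (trans (∑-cong n λ X →
          solve 3 (λ t x y → t :* x :* y := t :* y :* x) refl t (δ A X) (δ B Y))
          (∑-δ (λ _ → t * δ B Y) A))))
      ; feasible  = record
        { a-nonneg = remaining-nonneg a-nonneg t≤a
        ; b-nonneg = remaining-nonneg b-nonneg t≤b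
        ; downset  = λ {V} anti → downset′ anti _ _ ≡.refl ≡.refl
        }
      ; slack     = λ {V} anti → begin
          mass a⁻ V + mass b V
            ≈⟨ +-congˡ (mass-split b≈′ V) ⟩
          mass a⁻ V + (mass b⁻ V + t * 𝟙 (V B))
            ≤⟨ +-monoʳ-≤ _ (+-monoʳ-≤ _ (*-monoˡ-≤ 0≤t (𝟙-mono (anti A⊆B)))) ⟩
          mass a⁻ V + (mass b⁻ V + t * 𝟙 (V A))
            ≈⟨ solve 3 (λ x y z → x :+ (y :+ z) := (x :+ z) :+ y) refl _ _ _ ⟩
          (mass a⁻ V + t * 𝟙 (V A)) + mass b⁻ V
            ≈⟨ +-congʳ (mass-split a≈′ V) ⟨
          mass a V + mass b⁻ V ∎
      }
      where
      a⁻ b⁻ : Law n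
      a⁻ X = a X - t * δ A X
      b⁻ Y = b Y - t * δ B Y

      a≈′ : ∀ X → a X ≈ a⁻ X + t * δ A X
      a≈′ X = sym (trans (+-comm _ _) (x+[y-x]≈y _ (a X)))

      b≈′ : ∀ Y → b Y ≈ b⁻ Y + t * δ B Y
      b≈′ Y = sym (trans (+-comm _ _) (x+[y-x]≈y _ (b Y)))

      remaining-nonneg : ∀ {ν : Law n} {C} → (∀ X → 0# ≤ ν X) → t ≤ ν C →
                         ∀ X → 0# ≤ ν X - t * δ C X
      remaining-nonneg {ν} {C} 0≤ν t≤νC X = x≤y⇒0≤y-x le
        where
        le : t * δ C X ≤ ν X
        le with X ≟ˢ C
        ... | yes ≡.refl = ≤-trans (inj₂ (*-identityʳ t)) t≤νC
        ... | no _       = ≤-trans (inj₂ (zeroʳ t)) (0≤ν X)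

      𝟙-mono : ∀ {v w} → (v ≡ true → w ≡ true) → 𝟙 v ≤ 𝟙 w
      𝟙-mono {true}  {w} imp rewrite imp ≡.refl = ≤-refl
      𝟙-mono {false} {w} _   = 0≤𝟙 w

      support : ∀ X Y → ¬ X ⊆ Y → t * δ A X * δ B Y ≈ 0#
      support X Y X⊈Y with X ≟ˢ A | Y ≟ˢ B
      ... | yes ≡.refl | yes ≡.refl = ⊥-elim (X⊈Y A⊆B)
      ... | yes _      | no _       = zeroʳ _
      ... | no _       | yes _      = trans (*-congʳ (zeroʳ t)) (zeroˡ 1#)
      ... | no _       | no _       = zeroʳ _

      downset′ : ∀ {V} → Antitone V → ∀ v w → V A ≡ v → V B ≡ w → mass b⁻ V ≤ mass a⁻ V
      downset′ {V} anti v w VA≡v VB≡w = +-cancelʳ-≤ (t * 𝟙 (V A)) (begin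
        mass b⁻ V + t * 𝟙 (V A)   ≤⟨ go v w VA≡v VB≡w ⟩
        mass a V                  ≈⟨ mass-split a≈′ V ⟩
        mass a⁻ V + t * 𝟙 (V A)   ∎)
        where
        same : V A ≡ V B → mass b⁻ V + t * 𝟙 (V A) ≤ mass a V
        same eq = begin
          mass b⁻ V + t * 𝟙 (V A)   ≈⟨ +-congˡ (*-congˡ (reflexive (≡.cong 𝟙 eq))) ⟩
          mass b⁻ V + t * 𝟙 (V B)   ≈⟨ mass-split b≈′ V ⟨
          mass b V                  ≤⟨ downset anti ⟩
          mass a V                  ∎

        go : ∀ v w → V A ≡ v → V B ≡ w → mass b⁻ V + t * 𝟙 (V A) ≤ mass a V
        go true  true  VA VB = same (≡.trans VA (≡.sym VB))
        go false false VA VB = same (≡.trans VA (≡.sym VB))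
        go false true  VA VB with () ← ≡.trans (≡.sym VA) (anti A⊆B VB)
        go true  false VA VB = begin
          mass b⁻ V + t * 𝟙 (V A)
            ≈⟨ +-cong (trans (sym (+-identityʳ _))
                        (trans (+-congˡ (sym (trans (*-congˡ (reflexive (≡.cong 𝟙 VB))) (zeroʳ t))))
                               (sym (mass-split b≈′ V))))
                 (trans (*-congˡ (reflexive (≡.cong 𝟙 VA))) (*-identityʳ t)) ⟩
          mass b V + t
            ≤⟨ t≤slack anti VA VB ⟩
          mass a V ∎

    -- Sends the largest admissible amount. It is a minimum over finitely many constraints, and the
    -- one attained becomes an equality, which is a case of `Blocked`.
    saturate : ∃[ T ] Blocked (a′ T) (b′ T) A B
    saturate with min₂ (a A) (b B)
    ... | t₀ , t₀≤a , t₀≤b , t₀-attained = result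
      where
      -- V bounds the amount sent only if it separates A from B.
      bound : Bool → Bool → Carrier → Carrier
      bound true false s = s
      bound _    _     _ = t₀

      f : (Subset n → Bool) → Carrier
      f V = bound (V A) (V B) (mass a V - mass b V)

      0≤t₀ : 0# ≤ t₀
      0≤t₀ = [ (λ t₀≈a → ≤-trans (a-nonneg A) (inj₂ (sym t₀≈a)))
             , (λ t₀≈b → ≤-trans (b-nonneg B) (inj₂ (sym t₀≈b))) ]′ t₀-attained

      0≤f : ∀ V → V ∈ antitones n → 0# ≤ f V
      0≤f V V∈ with V A | V B
      ... | true  | false = x≤y⇒0≤y-x (downset (∈-antitones⁻ n V∈))
      ... | true  | true  = 0≤t₀
      ... | false | _     = 0≤t₀

      result : ∃[ T ] Blocked (a′ T) (b′ T) A B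
      result with minimum f t₀ (antitones n) 0≤f 0≤t₀
      ... | t , 0≤t , t≤t₀ , t≤f , t-attained = T , blocked t-attained
        where
        t≤slack : ∀ {V} → Antitone V → V A ≡ true → V B ≡ false → mass b V + t ≤ mass a V
        t≤slack {V} anti VA VB with ∈-antitones⁺ n anti
        ... | W , W∈ , V≡W = begin
          mass b V + t                       ≤⟨ +-monoʳ-≤ _ (t≤f W W∈) ⟩
          mass b V + f W                     ≈⟨ +-congˡ (reflexive fW≡) ⟩
          mass b V + (mass a W - mass b W)   ≈⟨ +-congʳ (mass-congʳ b V≡W) ⟩
          mass b W + (mass a W - mass b W)   ≈⟨ x+[y-x]≈y _ _ ⟩
          mass a W                           ≈⟨ mass-congʳ a V≡W ⟨
          mass a V                           ∎
          where
          fW≡ : f W ≡ mass a W - mass b W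
          fW≡ rewrite ≡.trans (≡.sym (V≡W A)) VA | ≡.trans (≡.sym (V≡W B)) VB = ≡.refl

        T : Transport a b
        T = send 0≤t (≤-trans t≤t₀ t₀≤a) (≤-trans t≤t₀ t₀≤b) t≤slack

        exhausted : ∀ {ν : Law n} {C} → t ≈ ν C → ν C - t * δ C C ≈ 0#
        exhausted {ν} {C} t≈νC = trans
          (+-congˡ (-‿cong (trans (*-congˡ (reflexive (δ-self C))) (trans (*-identityʳ t) t≈νC))))
          (-‿inverseʳ (ν C))

        empty : t ≈ t₀ → Blocked (a′ T) (b′ T) A B
        empty t≈t₀ = [ (λ t₀≈a → inj₁ (exhausted {a} (trans t≈t₀ t₀≈a)))
                     , (λ t₀≈b → inj₂ (inj₁ (exhausted {b} (trans t≈t₀ t₀≈b)))) ]′ t₀-attained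

        blocked : (t ≈ t₀ ⊎ ∃[ V ] V ∈ antitones n × t ≈ f V) → Blocked (a′ T) (b′ T) A B
        blocked (inj₁ t≈t₀)           = empty t≈t₀
        blocked (inj₂ (V , V∈ , t≈f)) = go (V A) (V B) ≡.refl ≡.refl t≈f
          where
          anti : Antitone V
          anti = ∈-antitones⁻ n V∈

          go : ∀ v w → V A ≡ v → V B ≡ w → t ≈ bound v w (mass a V - mass b V) →
               Blocked (a′ T) (b′ T) A B
          -- A downset that does not separate A from B contributes the default `t₀`, so a minimum
          -- attained there exhausts an endpoint.
          go true  true  _  _  t≈t₀ = empty t≈t₀
          go false _     _  _  t≈t₀ = empty t≈t₀
          go true  false VA VB t≈s  = inj₂ (inj₂ (V , anti , VA , VB ,
            ≤-antisym (+-cancelʳ-≤ t le) (Feasible.downset (feasible T) anti)))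
            where
            split : ∀ {ν ν′ : Law n} {C v} → (∀ X → ν X ≈ ν′ X + t * δ C X) → V C ≡ v →
                    mass ν V ≈ mass ν′ V + t * 𝟙 v
            split ν≈ ≡.refl = mass-split ν≈ V

            restore : ∀ {ν : Law n} {C} X → ν X ≈ (ν X - t * δ C X) + t * δ C X
            restore {ν} X = sym (trans (+-comm _ _) (x+[y-x]≈y _ (ν X)))

            le : mass (a′ T) V + t ≤ mass (b′ T) V + t
            le = begin
              mass (a′ T) V + t                   ≈⟨ +-congˡ (*-identityʳ t) ⟨
              mass (a′ T) V + t * 1#              ≈⟨ split {a} {a′ T} (restore {a}) VA ⟨
              mass a V                            ≈⟨ x+[y-x]≈y (mass b V) (mass a V) ⟨
              mass b V + (mass a V - mass b V)    ≈⟨ +-congˡ t≈s ⟨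
              mass b V + t                        ≈⟨ +-congʳ (split {b} {b′ T} (restore {b}) VB) ⟩
              mass (b′ T) V + t * 0# + t          ≈⟨ +-congʳ (trans (+-congˡ (zeroʳ t)) (+-identityʳ _)) ⟩
              mass (b′ T) V + t                   ∎

  saturate-all : ∀ {n} {a b : Law n} → Feasible a b → (es : List (Subset n × Subset n)) →
                 ∃[ T ] (∀ A B → (A , B) ∈ es → A ⊆ B → Blocked {n} (a′ {a = a} {b = b} T) (b′ T) A B)
  saturate-all feas [] = idle feas , λ _ _ ()
  saturate-all {n} {a} {b} feas ((A , B) ∷ es) with A ⊆? B
  ... | no A⊈B with saturate-all feas es
  ...   | T , blocked = T , λ
          { _ _ (here ≡.refl) A⊆B → ⊥-elim (A⊈B A⊆B)
          ; C D (there CD∈)       → blocked C D CD∈ }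
  saturate-all {n} {a} {b} feas ((A , B) ∷ es) | yes A⊆B with saturate feas A⊆B
  ...   | T , blockedAB with saturate-all (feasible T) es
  ...     | U , blocked = (T ⨾ U) , λ
            { _ _ (here ≡.refl) _ → blocked-persists U blockedAB
            ; C D (there CD∈)     → blocked C D CD∈ }

  module _ {n} {a b : Law n} (feas : Feasible a b)
           (blocked : ∀ A B → A ⊆ B → Blocked a b A B) where
    open Feasible feas

    -- Merges the separating downsets of many pairs with common upper end B into one, which then
    -- holds all the `a`-mass found below B among the listed sets.
    Covering : Subset n → List (Subset n) → Set
    Covering B As = ∃[ V ] Antitone V × V B ≡ false × mass a V ≈ mass b V ×
                    (∀ A → A ∈ As → A ⊆ B → a A ≈ 0# ⊎ V A ≡ true)

    -- Tight downsets are closed under union, as the slack is modular and nonnegative.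
    covering : ∀ B → ¬ b B ≈ 0# → ∀ As → Covering B As
    covering B b≉0 [] = const false , (λ _ ()) , ≡.refl
      , trans (∑-zero n λ A → zeroʳ (a A)) (sym (∑-zero n λ A → zeroʳ (b A))) , λ _ ()
    covering B b≉0 (A ∷ As) with covering B b≉0 As | A ⊆? B
    ... | V , antiV , V∌B , tightV , covers | no A⊈B =
      V , antiV , V∌B , tightV , λ
        { _ (here ≡.refl) A⊆B → ⊥-elim (A⊈B A⊆B)
        ; C (there C∈)        → covers C C∈ }
    ... | V , antiV , V∌B , tightV , covers | yes A⊆B with blocked A B A⊆B
    ...   | inj₁ a≈0        = V , antiV , V∌B , tightV , λ
            { _ (here ≡.refl) _ → inj₁ a≈0
            ; C (there C∈)      → covers C C∈ }
    ...   | inj₂ (inj₁ b≈0) = ⊥-elim (b≉0 b≈0)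
    ...   | inj₂ (inj₂ (W , antiW , W∋A , W∌B , tightW)) =
            V∨W , antiV∨W , ≡.cong₂ _∨_ V∌B W∌B
          , ≤-antisym (+-cancelʳ-≤ (mass a V∧W) le) (downset antiV∨W) , λ
            { _ (here ≡.refl) _ → inj₂ (∨-true⁺ʳ (V A) W∋A)
            ; C (there C∈) C⊆B  → weaken (covers C C∈ C⊆B) }
      where
      V∨W V∧W : Subset n → Bool
      V∨W C = V C ∨ W C
      V∧W C = V C ∧ W C

      weaken : ∀ {C} → a C ≈ 0# ⊎ V C ≡ true → a C ≈ 0# ⊎ V∨W C ≡ true
      weaken     (inj₁ a≈0) = inj₁ a≈0
      weaken {C} (inj₂ V∋C) = inj₂ (∨-true⁺ˡ (W C) V∋C)

      antiV∨W : Antitone V∨W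
      antiV∨W {C} {D} C⊆D ∋D with ∨-true⁻ (V D) ∋D
      ... | inj₁ V∋D = ∨-true⁺ˡ (W C) (antiV C⊆D V∋D)
      ... | inj₂ W∋D = ∨-true⁺ʳ (V C) (antiW C⊆D W∋D)

      antiV∧W : Antitone V∧W
      antiV∧W {C} {D} C⊆D ∋D with ∧-true⁻ (V D) ∋D
      ... | V∋D , W∋D = ∧-true⁺ (antiV C⊆D V∋D) (antiW C⊆D W∋D)

      le : mass a V∨W + mass a V∧W ≤ mass b V∨W + mass a V∧W
      le = begin
        mass a V∨W + mass a V∧W   ≈⟨ mass-modular a V W ⟩
        mass a V + mass a W       ≈⟨ +-cong tightV tightW ⟩
        mass b V + mass b W       ≈⟨ mass-modular b V W ⟨
        mass b V∨W + mass b V∧W   ≤⟨ +-monoʳ-≤ _ (downset antiV∧W) ⟩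
        mass b V∨W + mass a V∧W   ∎

    -- If mass remained at B, take a tight V avoiding B and holding all `a`-mass below B. Adjoining
    -- every subset of B to V adds nothing on the `a` side and at least `b B` on the `b` side, so
    -- feasibility of the enlarged downset forces `b B` to be zero.
    blocked⇒b≈0 : ∀ B → b B ≈ 0#
    blocked⇒b≈0 B with compare (b B) 0#
    ... | tri< b<0 _ _ = ⊥-elim (≤⇒≯ (b-nonneg B) b<0)
    ... | tri≈ _ b≈0 _ = b≈0
    ... | tri> _ b≉0 _ with covering B b≉0 (subsets n)
    ...   | V , antiV , V∌B , tight , covers =
            ≤-antisym (+-cancelʳ-≤ (mass b V) le) (b-nonneg B)
      where
      V⁺ : Subset n → Bool
      V⁺ A = V A ∨ does (A ⊆? B)

      antiV⁺ : Antitone V⁺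
      antiV⁺ {C} {D} C⊆D ∋D with ∨-true⁻ (V D) ∋D
      ... | inj₁ V∋D = ∨-true⁺ˡ _ (antiV C⊆D V∋D)
      ... | inj₂ D⊆B with D ⊆? B
      ...   | yes D⊆B′ = ∨-true⁺ʳ (V C) (dec-true (C ⊆? B) (Sub.⊆-trans C⊆D D⊆B′))
      ...   | no _ with () ← D⊆B

      a-side : ∀ A → a A * 𝟙 (V⁺ A) ≈ a A * 𝟙 (V A)
      a-side A with A ⊆? B
      ... | no _ = *-congˡ (reflexive (≡.cong 𝟙 (Bool.∨-identityʳ (V A))))
      ... | yes A⊆B with covers A (∈-subsets A) A⊆B
      ...   | inj₁ a≈0 = trans (*-congʳ a≈0) (trans (zeroˡ _) (sym (trans (*-congʳ a≈0) (zeroˡ _))))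
      ...   | inj₂ V∋A rewrite V∋A = refl

      b-side : ∀ A → b A * δ B A + b A * 𝟙 (V A) ≤ b A * 𝟙 (V⁺ A)
      b-side A with A ≟ˢ B
      ... | yes ≡.refl rewrite V∌B | dec-true (B ⊆? B) Sub.⊆-refl =
              inj₂ (trans (+-congˡ (zeroʳ _)) (+-identityʳ _))
      ... | no _ = begin
              b A * 0# + b A * 𝟙 (V A)   ≈⟨ trans (+-congʳ (zeroʳ _)) (+-identityˡ _) ⟩
              b A * 𝟙 (V A)              ≤⟨ *-monoˡ-≤ (b-nonneg A) (𝟙≤𝟙∨ (V A) _) ⟩
              b A * 𝟙 (V⁺ A)             ∎
        where
        𝟙≤𝟙∨ : ∀ v w → 𝟙 v ≤ 𝟙 (v ∨ w)
        𝟙≤𝟙∨ true  w = ≤-refl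
        𝟙≤𝟙∨ false w = 0≤𝟙 w

      le : b B + mass b V ≤ 0# + mass b V
      le = begin
        b B + mass b V
          ≈⟨ +-congʳ (∑-δ b B) ⟨
        ∑ (λ A → b A * δ B A) + mass b V
          ≈⟨ ∑-+ n (λ A → b A * δ B A) (λ A → b A * 𝟙 (V A)) ⟨
        ∑ (λ A → b A * δ B A + b A * 𝟙 (V A))
          ≤⟨ ∑-mono n b-side ⟩
        mass b V⁺
          ≤⟨ downset antiV⁺ ⟩
        mass a V⁺
          ≈⟨ ∑-cong n a-side ⟩
        mass a V
          ≈⟨ tight ⟩
        mass b V
          ≈⟨ +-identityˡ _ ⟨
        0# + mass b V ∎

  term≤∑ : ∀ {n} {f : Subset n → Carrier} → (∀ A → 0# ≤ f A) → ∀ A → f A ≤ ∑ f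
  term≤∑ {n} {f} 0≤f A = begin
    f A                       ≈⟨ ∑-δ f A ⟨
    ∑ (λ X → f X * δ A X)     ≤⟨ ∑-mono n (λ X → ≤-trans (*-monoˡ-≤ (0≤f X) (𝟙≤1 (does (X ≟ˢ A))))
                                                          (inj₂ (*-identityʳ (f X)))) ⟩
    ∑ f                       ∎
    where
    𝟙≤1 : ∀ v → 𝟙 v ≤ 1#
    𝟙≤1 true  = ≤-refl
    𝟙≤1 false = 0≤1

  strassen : ∀ {n} {a b : Law n} → (∀ A → 0# ≤ a A) → (∀ B → 0# ≤ b B) →
             ∑ a ≈ 1# → ∑ b ≈ 1# → (∀ {V} → Antitone V → mass b V ≤ mass a V) → a ≤d b
  strassen {n} {a} {b} 0≤a 0≤b ∑a≈1 ∑b≈1 down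
    with saturate-all (record { a-nonneg = 0≤a ; b-nonneg = 0≤b ; downset = down })
                      (cartesianProduct (subsets n) (subsets n))
  ... | T , blocked = κ T , (κ-nonneg T , total) , law₁≐a , law₂≐b , supported
    where
    open Feasible (feasible T)

    b′≈0 : ∀ B → b′ T B ≈ 0#
    b′≈0 = blocked⇒b≈0 (feasible T) λ A B →
      blocked A B (∈-cartesianProduct⁺ (∈-subsets A) (∈-subsets B))

    law₂≐b : law₂ (κ T) ≐ b
    law₂≐b B = sym (trans (b≈ T B) (trans (+-congʳ (b′≈0 B)) (+-identityˡ _)))

    total : ∑ (law₁ (κ T)) ≈ 1#
    total = trans (∑-swap n n (κ T)) (trans (∑-cong n law₂≐b) ∑b≈1)

    -- All of `b` has been delivered, so the transported mass is already 1, the total of `a`.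
    a′-total : ∑ (a′ T) ≤ 0#
    a′-total = +-cancelʳ-≤ 1# (inj₂ (begin-equality
      ∑ (a′ T) + 1#                          ≈⟨ +-congˡ total ⟨
      ∑ (a′ T) + ∑ (law₁ (κ T))              ≈⟨ ∑-+ n (a′ T) (law₁ (κ T)) ⟨
      ∑ (λ A → a′ T A + law₁ (κ T) A)        ≈⟨ ∑-cong n (a≈ T) ⟨
      ∑ a                                    ≈⟨ ∑a≈1 ⟩
      1#                                     ≈⟨ +-identityˡ 1# ⟨
      0# + 1#                                ∎))

    law₁≐a : law₁ (κ T) ≐ a
    law₁≐a A = sym (trans (a≈ T A) (trans (+-congʳ a′≈0) (+-identityˡ _)))
      where
      a′≈0 : a′ T A ≈ 0#
      a′≈0 = ≤-antisym (≤-trans (term≤∑ a-nonneg A) a′-total) (a-nonneg A)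

    supported : Pr₂ (κ T) _⊆?_ ≈ 1#
    supported = trans (∑-cong n λ A → ∑-cong n λ B → on-support A B) total
      where
      on-support : ∀ A B → (if does (A ⊆? B) then κ T A B else 0#) ≈ κ T A B
      on-support A B with A ⊆? B
      ... | yes _  = refl
      ... | no A⊈B = sym (κ-support T A B A⊈B)

-- Thinning a spread set.

module Thinning (ℝ : CompleteOrderedField) where
  open Strassen ℝ
  open Sums ℝ
  open Constants ℝ
  open Solver

  mass-law∩ : ∀ {n} (κ : JointLaw n) V →
              mass (law∩ κ) V ≈ ∑ λ A → ∑ λ B → κ A B * 𝟙 (V (A ∩ B))
  mass-law∩ {n} κ V = begin-equality
    ∑ (λ C → (∑ λ A → ∑ λ B → at A B C) * 𝟙 (V C))
      ≈⟨ ∑-cong n (λ C → trans (sym (∑-*ʳ n (𝟙 (V C)) λ A → ∑ λ B → at A B C))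
           (∑-cong n λ A → sym (∑-*ʳ n (𝟙 (V C)) λ B → at A B C))) ⟩
    ∑ (λ C → ∑ λ A → ∑ λ B → at A B C * 𝟙 (V C))
      ≈⟨ ∑-swap n n (λ C A → ∑ λ B → at A B C * 𝟙 (V C)) ⟩
    ∑ (λ A → ∑ λ C → ∑ λ B → at A B C * 𝟙 (V C))
      ≈⟨ ∑-cong n (λ A → ∑-swap n n (λ C B → at A B C * 𝟙 (V C))) ⟩
    ∑ (λ A → ∑ λ B → ∑ λ C → at A B C * 𝟙 (V C))
      ≈⟨ ∑-cong n (λ A → ∑-cong n λ B →
           trans (∑-single (A ∩ B) (off A B)) (*-congʳ (on A B))) ⟩
    ∑ (λ A → ∑ λ B → κ A B * 𝟙 (V (A ∩ B))) ∎
    where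
    at : Subset n → Subset n → Subset n → Carrier
    at A B C = if does ((A ∩ B) ≟ˢ C) then κ A B else 0#

    off : ∀ A B C → C ≢ A ∩ B → at A B C * 𝟙 (V C) ≈ 0#
    off A B C C≢ rewrite dec-false ((A ∩ B) ≟ˢ C) (C≢ ∘ ≡.sym) = zeroˡ _

    on : ∀ A B → at A B (A ∩ B) ≈ κ A B
    on A B rewrite dec-true ((A ∩ B) ≟ˢ (A ∩ B)) ≡.refl = refl

  module _ {α p : Carrier} (0<α : 0# < α) (αα+α≤1 : α * α + α ≤ 1#)
           (0<p : 0# < p) (p<1 : p < 1#) where
    private
      0≤α : 0# ≤ α
      0≤α = inj₁ 0<α

      0≤p : 0# ≤ p
      0≤p = inj₁ 0<p

      p≤1 : p ≤ 1#
      p≤1 = inj₁ p<1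

      ᾱ : Carrier
      ᾱ = 1# - α

      αα≤ᾱ : α * α ≤ ᾱ
      αα≤ᾱ = +-cancelʳ-≤ α (≤-trans αα+α≤1 (inj₂ (sym (1-x+x≈1 α))))

      0<ᾱ : 0# < ᾱ
      0<ᾱ with αα≤ᾱ
      ... | inj₁ αα<ᾱ = <-trans (*-pos 0<α 0<α) αα<ᾱ
      ... | inj₂ αα≈ᾱ = <-respʳ-≈ αα≈ᾱ (*-pos 0<α 0<α)

      α≤1 : α ≤ 1#
      α≤1 = ≤-trans (x≤x+y α (inj₁ 0<ᾱ)) (inj₂ (x+[y-x]≈y α 1#))

    thinned≤ : ∀ N (κ : JointLaw N) → IsProbability κ → Spread (α * p) (law₁ κ) →
               law₂ κ ≐ μ α → Independent κ → law∩ κ ≤d μ p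
    thinned≤ N κ (0≤κ , κ-total) spread law₂≐μ indep
      with inverse ᾱ (λ ᾱ≈0 → <-irrefl (sym ᾱ≈0) 0<ᾱ)
    ... | γ , ᾱγ≈1 = strassen ∩-nonneg (μ-nonneg 0≤p p≤1) ∩-total (μ-total N p) downset
      where
      ν : Law N
      ν = law₁ κ

      ν-nonneg : ∀ J → 0# ≤ ν J
      ν-nonneg J = ∑-nonneg N (0≤κ J)

      -- The odds α / (1 - α).
      ℓ : Carrier
      ℓ = α * γ

      0≤γ : 0# ≤ γ
      0≤γ with ≤-total 0# γ
      ... | inj₁ 0≤γ = 0≤γ
      ... | inj₂ γ≤0 = ⊥-elim (≤⇒≯ 1≤0 0<1)
        where
        1≤0 : 1# ≤ 0#
        1≤0 = begin
          1#       ≈⟨ ᾱγ≈1 ⟨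
          ᾱ * γ    ≤⟨ *-monoˡ-≤ (inj₁ 0<ᾱ) γ≤0 ⟩
          ᾱ * 0#   ≈⟨ zeroʳ ᾱ ⟩
          0#       ∎

      ᾱ[1+ℓ]≈1 : ᾱ * (1# + ℓ) ≈ 1#
      ᾱ[1+ℓ]≈1 = begin-equality
        ᾱ * (1# + α * γ)        ≈⟨ solve 3 (λ a ā g → ā :* (con 1 :+ a :* g) := ā :+ a :* (ā :* g))
                                     refl α ᾱ γ ⟩
        ᾱ + α * (ᾱ * γ)         ≈⟨ +-congˡ (trans (*-congˡ ᾱγ≈1) (*-identityʳ α)) ⟩
        ᾱ + α                   ≈⟨ 1-x+x≈1 α ⟩
        1#                      ∎

      -- The quadratic condition on α enters the estimate here: ℓ α ≤ 1 amounts to α² ≤ 1 - α.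
      ℓαp≤p : ℓ * (α * p) ≤ p
      ℓαp≤p = begin
        α * γ * (α * p)   ≈⟨ solve 3 (λ a g p → a :* g :* (a :* p) := a :* a :* (g :* p)) refl α γ p ⟩
        α * α * (γ * p)   ≤⟨ *-monoʳ-≤ (*-nonneg 0≤γ 0≤p) αα≤ᾱ ⟩
        ᾱ * (γ * p)       ≈⟨ *-assoc ᾱ γ p ⟨
        ᾱ * γ * p         ≈⟨ trans (*-congʳ ᾱγ≈1) (*-identityˡ p) ⟩
        p                 ∎

      open Certificate ℝ p ℓ

      survival : (Subset N → Bool) → Subset N → Carrier
      survival V J = 𝔼 N α λ B → 𝟙 (V (J ∩ B))

      mass-∩ : ∀ V → mass (law∩ κ) V ≈ ∑ λ J → ν J * survival V J
      mass-∩ V = trans (mass-law∩ κ V) (∑-cong N λ J → trans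
        (∑-cong N λ B → trans
          (*-congʳ (trans (indep J B) (*-congˡ (law₂≐μ B))))
          (*-assoc (ν J) (μ α B) (𝟙 (V (J ∩ B)))))
        (∑-*ˡ N (ν J) λ B → μ α B * 𝟙 (V (J ∩ B))))

      ∩-nonneg : ∀ C → 0# ≤ law∩ κ C
      ∩-nonneg C = ∑-nonneg N λ A → ∑-nonneg N λ B → go A B
        where
        go : ∀ A B → 0# ≤ (if does ((A ∩ B) ≟ˢ C) then κ A B else 0#)
        go A B with (A ∩ B) ≟ˢ C
        ... | yes _ = 0≤κ A B
        ... | no _  = ≤-refl

      ∩-total : ∑ (law∩ κ) ≈ 1#
      ∩-total = begin-equality
        ∑ (law∩ κ)                         ≈⟨ mass-true (law∩ κ) ⟨
        mass (law∩ κ) (const true)         ≈⟨ mass-law∩ κ (const true) ⟩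
        ∑ (λ A → ∑ λ B → κ A B * 1#)       ≈⟨ ∑-cong N (λ A → ∑-cong N λ B → *-identityʳ (κ A B)) ⟩
        ∑ (λ A → ∑ λ B → κ A B)            ≈⟨ κ-total ⟩
        1#                                 ∎

      spread′ : ∀ I → Pr ν (I ⊆?_) ≤ 1# * (α * p) ^ ∣ I ∣
      spread′ I = ≤-trans (spread I) (inj₂ (sym (*-identityˡ _)))

      downset : ∀ {V} → Antitone V → mass (μ p) V ≤ mass (law∩ κ) V
      -- Averaging `tangent` gives 2E ≤ P(J ∩ X ∈ V) + E, the last E being the mean of h² = h; one E
      -- cancels.
      downset {V} anti = +-cancelʳ-≤ E (begin
        E + E
          ≈⟨ trans (*-congʳ κ-total) (*-identityˡ (E + E)) ⟨
        ∑ ν * (E + E)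
          ≈⟨ ∑-*ʳ N (E + E) ν ⟨
        ∑ (λ J → ν J * (E + E))
          ≤⟨ ∑-mono N (λ J → *-monoˡ-≤ (ν-nonneg J) (tangent 0≤α α≤1 ᾱ[1+ℓ]≈1 J anti h h≈0)) ⟩
        ∑ (λ J → ν J * (survival V J + Q J h))
          ≈⟨ ∑-cong N (λ J → distribˡ (ν J) (survival V J) (Q J h)) ⟩
        ∑ (λ J → ν J * survival V J + ν J * Q J h)
          ≈⟨ ∑-+ N (λ J → ν J * survival V J) (λ J → ν J * Q J h) ⟩
        ∑ (λ J → ν J * survival V J) + ∑ (λ J → ν J * Q J h)
          ≤⟨ +-mono-≤ (inj₂ (sym (mass-∩ V)))
               (Q-spread 0≤p p≤1 (*-nonneg 0≤α 0≤γ) (*-nonneg 0≤α 0≤p) ℓαp≤p N 1# 0≤1 ν spread′ h) ⟩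
        mass (law∩ κ) V + 1# * 𝔼 N p (λ A → h A * h A)
          ≈⟨ +-congˡ (trans (*-identityˡ _) (𝔼-cong N p λ A → 𝟙-idem (V A))) ⟩
        mass (law∩ κ) V + E ∎)
        where
        h : Subset N → Carrier
        h A = 𝟙 (V A)

        h≈0 : ∀ A → V A ≡ false → h A ≈ 0#
        h≈0 A V∌A = reflexive (≡.cong 𝟙 V∌A)

        E : Carrier
        E = 𝔼 N p h

  -- Admissible values of α.

  0<½ : 0# < ½
  0<½ with compare 0# ½
  ... | tri< 0<½ _ _ = 0<½
  ... | tri≈ _ 0≈½ _ =
    ⊥-elim (<-irrefl (trans (sym (zeroʳ 2#)) (trans (*-congˡ 0≈½) (proj₂ half))) 0<1)
  ... | tri> _ _ ½<0 = ⊥-elim (≤⇒≯ 1≤0 0<1)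
    where
    1≤0 : 1# ≤ 0#
    1≤0 = begin
      1#       ≈⟨ proj₂ half ⟨
      2# * ½   ≤⟨ *-monoˡ-≤ (+-nonneg 0≤1 0≤1) (inj₁ ½<0) ⟩
      2# * 0#  ≈⟨ zeroʳ 2# ⟩
      0#       ∎

  ½+½≈1 : ½ + ½ ≈ 1#
  ½+½≈1 = trans (solve 1 (λ h → h :+ h := (con 1 :+ con 1) :* h) refl ½) (proj₂ half)

  -- The quadratic condition is checked directly for ½, avoiding a numerical estimate of `√5`.
  ½½+½≤1 : ½ * ½ + ½ ≤ 1#
  ½½+½≤1 = begin
    ½ * ½ + ½    ≤⟨ +-monoˡ-≤ ½ (*-monoˡ-≤ (inj₁ 0<½) ½≤1) ⟩
    ½ * 1# + ½   ≈⟨ +-congʳ (*-identityʳ ½) ⟩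
    ½ + ½        ≈⟨ ½+½≈1 ⟩
    1#           ∎
    where
    ½≤1 : ½ ≤ 1#
    ½≤1 = ≤-trans (x≤x+y ½ (inj₁ 0<½)) (inj₂ ½+½≈1)

  golden : Carrier
  golden = (√5 - 1#) * ½

  golden² : golden * golden + golden ≈ 1#
  golden² = begin-equality
    (t * ½) * (t * ½) + t * ½
      ≈⟨ +-congˡ (*-identityʳ (t * ½)) ⟨
    (t * ½) * (t * ½) + t * ½ * 1#
      ≈⟨ +-congˡ (*-congˡ ½+½≈1) ⟨
    (t * ½) * (t * ½) + t * ½ * (½ + ½)
      ≈⟨ solve 2 (λ t h → (t :* h) :* (t :* h) :+ t :* h :* (h :+ h) :=
           (t :* t :+ (t :+ t)) :* (h :* h)) refl t ½ ⟩
    (t * t + (t + t)) * (½ * ½)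
      ≈⟨ *-congʳ t²+2t≈4 ⟩
    (2# + 2#) * (½ * ½)
      ≈⟨ solve 1 (λ h → ((con 1 :+ con 1) :+ (con 1 :+ con 1)) :* (h :* h) :=
           (h :+ h) :* (h :+ h)) refl ½ ⟩
    (½ + ½) * (½ + ½)
      ≈⟨ trans (*-cong ½+½≈1 ½+½≈1) (*-identityˡ 1#) ⟩
    1# ∎
    where
    t = √5 - 1#

    -- Completing the square: (t + 1)² = 5.
    t²+2t≈4 : t * t + (t + t) ≈ 2# + 2#
    t²+2t≈4 = begin-equality
      t * t + (t + t)
        ≈⟨ [x+z]-z≈x _ 1# ⟨
      (t * t + (t + t) + 1#) - 1#
        ≈⟨ +-congʳ (solve 1 (λ t → t :* t :+ (t :+ t) :+ con 1 := (t :+ con 1) :* (t :+ con 1)) refl t) ⟩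
      (t + 1#) * (t + 1#) - 1#
        ≈⟨ +-congʳ (*-cong t+1≈√5 t+1≈√5) ⟩
      √5 * √5 - 1#
        ≈⟨ +-congʳ (proj₂ (proj₂ sqrt5)) ⟩
      (2# + 2# + 1#) - 1#
        ≈⟨ [x+z]-z≈x _ 1# ⟩
      2# + 2# ∎
      where
      t+1≈√5 : t + 1# ≈ √5
      t+1≈√5 = trans (+-comm t 1#) (x+[y-x]≈y 1# √5)

  -- The polynomial x² + x increases on positive x and equals 1 at `golden`.
  αα+α≤1 : ∀ {α} → 0# < α → α ≤ golden → α * α + α ≤ 1#
  αα+α≤1 {α} 0<α α≤g = begin
    α * α + α                 ≤⟨ +-mono-≤ (≤-trans (*-monoˡ-≤ (inj₁ 0<α) α≤g)
                                   (*-monoʳ-≤ (≤-trans (inj₁ 0<α) α≤g) α≤g)) α≤g ⟩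
    golden * golden + golden  ≈⟨ golden² ⟩
    1#                        ∎

corollary1p3 : (ℝ : CompleteOrderedField) →
    let open CompleteOrderedField ℝ
        open Constants ℝ
        open RandomSets ℝ
    in
      (∀ α → 0# < α → α ≤ (√5 - 1#) * ½ →
       ∀ (N : ℕ) → 1 ℕ.≤ N →
       ∀ p → 0# < p → p < 1# →
       ∀ (κ : JointLaw N) → IsProbability κ →
       Spread (α * p) (law₁ κ) →
       law₂ κ ≐ μ α →
       Independent κ →
       law∩ κ ≤d μ p)
      ×
      (∀ (N : ℕ) → 1 ℕ.≤ N →
       ∀ p → 0# < p → p < 1# →
       ∀ (κ : JointLaw N) → IsProbability κ →
       Spread (½ * p) (law₁ κ) →
       law₂ κ ≐ μ ½ →
       Independent κ →
       law∩ κ ≤d μ p)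
corollary1p3 ℝ =
  (λ α 0<α α≤g N _ p 0<p p<1 → thinned≤ 0<α (αα+α≤1 0<α α≤g) 0<p p<1 N) ,
  (λ N _ p 0<p p<1 → thinned≤ 0<½ ½½+½≤1 0<p p<1 N)
  where open Thinning ℝ
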